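{- Let $n\ge 1$. For integers $0\le k_1<k_2<\cdots<k_n$, the coefficient of $X_1^{k_1}X_2^{k_2}\cdots X_n^{k_n}$ in $$\prod_{i=1}^n\frac{1}{X_i^{n-1}(1-X_i)^n}\prod_{1\le i<j\le n}(X_j-X_i)(1-X_j+X_iX_j),$$ interpreted as a formal Laurent series with $\frac{1}{1-X_i}=\sum_{j\ge0}X_i^j$, is equal to the number of monotone triangles with bottom row $(k_1,\ldots,k_n)$.
   Context: A monotone triangle with $n$ rows is a triangular array of integers $(a_{i,j})_{1\le j\le i\le n}$ such that $a_{i,j}\le a_{i-1,j}\le a_{i,j+1}$ and $a_{i,j}<a_{i,j+1}$ whenever the entries are defined; its bottom row is $(a_{n,1},\ldots,a_{n,n})$. -}

module Defs where

open import Data.Nat as ℕ using (ℕ; zero; suc; _∸_)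
open import Data.Nat.Properties as ℕP using ()
open import Data.Integer as ℤ using (ℤ; _≤_; _<_)
open import Data.Fin as Fin using (Fin; toℕ; inject₁)
open import Data.Vec as Vec using (Vec; []; _∷_; lookup; replicate; _[_]≔_)
open import Data.Vec.Properties using (≡-dec)
open import Data.List as List using (List; []; _∷_; map; concatMap; upTo; allFin; filter; cartesianProduct; foldr)
open import Data.Product using (_×_; _,_; proj₁; proj₂)
open import Data.Unit using (⊤)
open import Relation.Nullary using (yes; no)

-- Formal power series in n variables X₁..Xₙ with integer coefficients:
-- an exponent vector e ∈ ℕⁿ is mapped to the coefficient of X^e.

PS : ℕ → Set
PS n = Vec ℕ n → ℤ

splits : ∀ {n} → Vec ℕ n → List (Vec ℕ n × Vec ℕ n)
splits []       = ([] , []) ∷ []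
splits (x ∷ e) =
  concatMap (λ a → map (λ p → (a ∷ proj₁ p , (x ∸ a) ∷ proj₂ p)) (splits e))
            (upTo (suc x))

sumℤ : List ℤ → ℤ
sumℤ = foldr ℤ._+_ (ℤ.+ 0)

_⊛_ : ∀ {n} → PS n → PS n → PS n
(f ⊛ g) e = sumℤ (map (λ p → f (proj₁ p) ℤ.* g (proj₂ p)) (splits e))

_⊕_ : ∀ {n} → PS n → PS n → PS n
(f ⊕ g) e = f e ℤ.+ g e

_⊖_ : ∀ {n} → PS n → PS n → PS n
(f ⊖ g) e = f e ℤ.- g e

const : ∀ {n} → ℤ → PS n
const {n} c e with ≡-dec ℕ._≟_ e (replicate n 0)
... | yes _ = c
... | no  _ = ℤ.+ 0

var : ∀ {n} → Fin n → PS n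
var {n} i e with ≡-dec ℕ._≟_ e (replicate n 0 [ i ]≔ 1)
... | yes _ = ℤ.+ 1
... | no  _ = ℤ.+ 0

-- 1/(1 - X_i) = Σ_{j≥0} X_i^j
geom : ∀ {n} → Fin n → PS n
geom {n} i e with ≡-dec ℕ._≟_ e (replicate n 0 [ i ]≔ lookup e i)
... | yes _ = ℤ.+ 1
... | no  _ = ℤ.+ 0

prodPS : ∀ {n} → List (PS n) → PS n
prodPS = foldr _⊛_ (const (ℤ.+ 1))

powPS : ∀ {n} → PS n → ℕ → PS n
powPS f zero    = const (ℤ.+ 1)
powPS f (suc k) = f ⊛ powPS f k

pairsLt : ∀ n → List (Fin n × Fin n)
pairsLt n = filter (λ p → toℕ (proj₁ p) ℕ.<? toℕ (proj₂ p))
                   (cartesianProduct (allFin n) (allFin n))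

mainPS : ∀ n → PS n
mainPS n =
  prodPS (map (λ i → powPS (geom i) n) (allFin n))
  ⊛ prodPS (map (λ p → (var (proj₂ p) ⊖ var (proj₁ p))
                        ⊛ ((const (ℤ.+ 1) ⊖ var (proj₂ p))
                           ⊕ (var (proj₁ p) ⊛ var (proj₂ p))))
                (pairsLt n))

-- Coefficient of X^k in the formal Laurent series  (Π_i X_i^{-s}) · F,
-- for k ∈ ℕⁿ: it is the coefficient of X^(k + (s,…,s)) in F.
coeffShift : ∀ {n} → ℕ → PS n → Vec ℕ n → ℤ
coeffShift s F k = F (Vec.map (λ a → a ℕ.+ s) k)

theCoeff : ∀ n → Vec ℕ n → ℤ
theCoeff n k = coeffShift (n ∸ 1) (mainPS n) k

Tri : ℕ → Set
Tri zero    = ⊤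
Tri (suc n) = Tri n × Vec ℤ (suc n)

bottom : ∀ {n} → Tri (suc n) → Vec ℤ (suc n)
bottom = proj₂

StrictRow : ∀ {m} → Vec ℤ (suc m) → Set
StrictRow {m} r = (j : Fin m) → lookup r (inject₁ j) < lookup r (Fin.suc j)

Interlace : ∀ {m} → Vec ℤ m → Vec ℤ (suc m) → Set
Interlace {m} prev r = (j : Fin m) →
  (lookup r (inject₁ j) ≤ lookup prev j) × (lookup prev j ≤ lookup r (Fin.suc j))

Monotone : ∀ {n} → Tri n → Set
Monotone {zero}        _       = ⊤
Monotone {suc zero}    (_ , r) = StrictRow r
Monotone {suc (suc n)} (t , r) = Monotone t × Interlace (bottom t) r × StrictRow r

{-# OPTIONS --safe #-}
module Submission where

-- On coefficient functions of the variables k₁, …, kₙ the factor (1 - X_q + X_p X_q)/(X_p X_q) acts as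
-- the operator V_pq = 1 + E_p Δ_q (E = shift, Δ = E - 1), so the coefficient is Pₙ = ∏_{p<q} V_pq Dₙ where Dₙ
-- is the coefficient function of ∏ (1 - X_i)⁻ⁿ ∏_{i<j} (X_j - X_i).
--
-- Let Gₙ be the antisymmetric function with Δ₁⋯Δₙ Gₙ = Dₙ vanishing on the coordinate hyperplanes.
-- A Vandermonde-type identity gives Dₙ₊₁(k) = ∑_r ± Gₙ(k without k_r).  On a function that is constant
-- in k_r one has V_rq = E_q and V_pr = 1, so with H = ∏ V_pq Gₙ
--   Pₙ₊₁(k) = ∑_r ± H(k₁, …, k_{r-1}, k_{r+1} + 1, …, k_{n+1} + 1).
-- Antisymmetry of Gₙ makes V_{i+1,i} H antisymmetric in k_i and k_{i+1}.  The right-hand side is therefore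
-- the telescoped sum of Δ₁⋯Δₙ H = Pₙ over the strictly increasing rows interlacing k, which is the
-- recursion satisfied by the number of monotone triangles.

open import Defs
open import Data.Fin using (Fin; zero; suc; toℕ; inject₁; punchIn)
open import Data.Integer as ℤ using (ℤ; 0ℤ; 1ℤ)
import Data.Integer.Properties as ℤ
open import Data.Integer.Tactic.RingSolver using (solve-∀)
open import Data.List as List using (List; []; _∷_; _++_; concatMap; applyUpTo; upTo; tabulate; allFin; filter; cartesianProduct; length)
import Data.List.Properties as List
open import Data.Nat as ℕ using (ℕ; zero; suc; _∸_; _⊔_; z≤n; s≤s)
import Data.Nat.Properties as ℕ
open import Data.Product using (_×_; _,_; proj₁; proj₂; ∃; Σ)
open import Data.Unit using (⊤; tt)
open import Data.Vec using (Vec; []; _∷_; lookup; map; replicate; removeAt; insertAt; _[_]≔_)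
import Data.Vec.Properties as Vec
open import Function using (_∘_; id)
open import Level using (0ℓ)

-- What remains are upward shifts only, and all exponents stay in ℕ.
--
-- The obstacle is strictness. Interlacing alone confines the entries of a row to independent
-- intervals, over which Δ₁⋯Δₙ H telescopes at once. Strictness couples neighbours: if k is the
-- entry between l_i and l_{i+1}, then l_i = k forces l_{i+1} ≥ k + 1. The boundary terms that
-- involve both l_i and l_{i+1} combine to V_{i+1,i} H at the point where both coordinates equal k,
-- and antisymmetry makes this vanish.
--
-- H itself is not antisymmetric, because ∏_{p<q} V_pq is not symmetric. Exchanging i and i + 1
-- permutes all factors except V_{i,i+1}, which becomes V_{i+1,i}; the additional factor V_{i+1,i}
-- therefore completes the product to an operator symmetric in these two variables, applied to the
-- antisymmetric Gₙ.

private variable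
  n m k : ℕ

-- The commutative ring of formal power series

module PowerSeriesRing where
  open import Algebra.Bundles using (CommutativeRing)
  import Algebra.Solver.Ring as RingSolver
  import Algebra.Solver.Ring.AlmostCommutativeRing as ACR
  open import Algebra.Structures using (IsCommutativeRing)
  open import Data.Integer using (_+_; _*_; -_)
  open import Data.Integer.Properties
  open import Data.Maybe using (Maybe; just; nothing)
  open import Relation.Binary.PropositionalEquality
  open import Relation.Nullary using (yes; no; contradiction)
  open ≡-Reasoning

  infixl 30 _⟨_⟩
  infix 4 _≈_
  _⟨_⟩ : PS (suc n) → ℕ → PS n
  (f ⟨ a ⟩) e = f (a ∷ e)

  tail₀ : PS (suc n) → PS (suc n)
  tail₀ f (a ∷ e) = f (suc a ∷ e)

  _≈_ : PS n → PS n → Set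
  f ≈ g = ∀ e → f e ≡ g e

  infixl 7 _·_
  opaque
    _·_ : PS n → PS n → PS n
    _·_ = _⊛_

    ·≡⊛ : ∀ (f g : PS n) → f · g ≡ f ⊛ g
    ·≡⊛ f g = refl

  sumℤ-++ : ∀ xs ys → sumℤ (xs ++ ys) ≡ sumℤ xs + sumℤ ys
  sumℤ-++ []       ys = sym (+-identityˡ _)
  sumℤ-++ (x ∷ xs) ys = trans (cong (x +_) (sumℤ-++ xs ys)) (sym (+-assoc x _ _))

  sumℤ-concatMap : ∀ {A B : Set} (F : B → ℤ) (g : A → List B) xs →
    sumℤ (List.map F (concatMap g xs)) ≡ sumℤ (List.map (λ a → sumℤ (List.map F (g a))) xs)
  sumℤ-concatMap F g []       = refl
  sumℤ-concatMap F g (x ∷ xs) = begin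
    sumℤ (List.map F (g x ++ concatMap g xs))
      ≡⟨ cong sumℤ (List.map-++ F (g x) _) ⟩
    sumℤ (List.map F (g x) ++ List.map F (concatMap g xs))
      ≡⟨ sumℤ-++ (List.map F (g x)) _ ⟩
    sumℤ (List.map F (g x)) + sumℤ (List.map F (concatMap g xs))
      ≡⟨ cong (λ s → sumℤ (List.map F (g x)) + s) (sumℤ-concatMap F g xs) ⟩
    _ ∎

  opaque
    unfolding _·_

    ·-∷ : ∀ (f g : PS (suc n)) x e →
      (f · g) (x ∷ e) ≡ sumℤ (applyUpTo (λ a → (f ⟨ a ⟩ · g ⟨ x ∸ a ⟩) e) (suc x))
    ·-∷ {n} f g x e = begin
      (f ⊛ g) (x ∷ e)
        ≡⟨ sumℤ-concatMap F (λ a → List.map (G a) (splits e)) (upTo (suc x)) ⟩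
      sumℤ (List.map (λ a → sumℤ (List.map F (List.map (G a) (splits e)))) (upTo (suc x)))
        ≡⟨ cong sumℤ (List.map-cong {g = H} (λ a → cong sumℤ (sym (List.map-∘ {g = F} {f = G a} (splits e)))) (upTo (suc x))) ⟩
      sumℤ (List.map H (upTo (suc x)))
        ≡⟨ cong sumℤ (List.map-upTo H (suc x)) ⟩
      sumℤ (applyUpTo H (suc x)) ∎
      where
      F : Vec ℕ (suc n) × Vec ℕ (suc n) → ℤ
      F p = f (proj₁ p) * g (proj₂ p)
      G : ℕ → Vec ℕ n × Vec ℕ n → Vec ℕ (suc n) × Vec ℕ (suc n)
      G a p = a ∷ proj₁ p , (x ∸ a) ∷ proj₂ p
      H : ℕ → ℤ
      H a = (f ⟨ a ⟩ ⊛ g ⟨ x ∸ a ⟩) e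

    ·-[] : ∀ (f g : PS 0) → (f · g) [] ≡ f [] * g []
    ·-[] f g = +-identityʳ (f [] * g [])

    ·-cong : {f f′ g g′ : PS n} → f ≈ f′ → g ≈ g′ → f · g ≈ f′ · g′
    ·-cong p q e = cong sumℤ (List.map-cong (λ s → cong₂ _*_ (p (proj₁ s)) (q (proj₂ s))) (splits e))

  ·-zero : ∀ (f g : PS (suc n)) e → (f · g) (0 ∷ e) ≡ (f ⟨ 0 ⟩ · g ⟨ 0 ⟩) e
  ·-zero f g e = trans (·-∷ f g 0 e) (+-identityʳ ((f ⟨ 0 ⟩ · g ⟨ 0 ⟩) e))

  -- Writing f = f₀ + X₀ · `tail₀ f` with f₀ free of X₀ splits the product in two. This recursion on
  -- the first exponent replaces the sum over `splits` in the proofs of the ring laws.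
  ·-suc : ∀ (f g : PS (suc n)) x e →
    (f · g) (suc x ∷ e) ≡ (f ⟨ 0 ⟩ · g ⟨ suc x ⟩) e + (tail₀ f · g) (x ∷ e)
  ·-suc f g x e = trans (·-∷ f g (suc x) e) (cong (λ s → (f ⟨ 0 ⟩ · g ⟨ suc x ⟩) e + s) (sym (·-∷ (tail₀ f) g x e)))

  -- The convolution is split at its last term instead of its first; comparing the two forms gives
  -- commutativity.
  ·-sucʳ : ∀ (f g : PS (suc n)) x e →
    (f · g) (suc x ∷ e) ≡ (f · tail₀ g) (x ∷ e) + (f ⟨ suc x ⟩ · g ⟨ 0 ⟩) e
  ·-sucʳ f g zero e = trans (·-suc f g 0 e)
    (cong₂ _+_ (sym (·-zero f (tail₀ g) e)) (·-zero (tail₀ f) g e))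
  ·-sucʳ f g (suc x) e = begin
    (f · g) (suc (suc x) ∷ e)
      ≡⟨ ·-suc f g (suc x) e ⟩
    (f ⟨ 0 ⟩ · g ⟨ suc (suc x) ⟩) e + (tail₀ f · g) (suc x ∷ e)
      ≡⟨ cong (λ s → (f ⟨ 0 ⟩ · g ⟨ suc (suc x) ⟩) e + s) (·-sucʳ (tail₀ f) g x e) ⟩
    (f ⟨ 0 ⟩ · g ⟨ suc (suc x) ⟩) e + ((tail₀ f · tail₀ g) (x ∷ e) + (f ⟨ suc (suc x) ⟩ · g ⟨ 0 ⟩) e)
      ≡⟨ sym (+-assoc ((f ⟨ 0 ⟩ · g ⟨ suc (suc x) ⟩) e) _ _) ⟩
    (f ⟨ 0 ⟩ · g ⟨ suc (suc x) ⟩) e + (tail₀ f · tail₀ g) (x ∷ e) + (f ⟨ suc (suc x) ⟩ · g ⟨ 0 ⟩) e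
      ≡⟨ cong (λ s → s + (f ⟨ suc (suc x) ⟩ · g ⟨ 0 ⟩) e) (sym (·-suc f (tail₀ g) x e)) ⟩
    _ ∎

  ·-comm : ∀ (f g : PS n) → (f · g) ≈ (g · f)
  ·-comm f g [] = trans (·-[] f g) (trans (*-comm (f []) (g [])) (sym (·-[] g f)))
  ·-comm f g (zero ∷ e) = trans (·-zero f g e) (trans (·-comm (f ⟨ 0 ⟩) (g ⟨ 0 ⟩) e) (sym (·-zero g f e)))
  ·-comm f g (suc x ∷ e) = begin
    (f · g) (suc x ∷ e)
      ≡⟨ ·-suc f g x e ⟩
    (f ⟨ 0 ⟩ · g ⟨ suc x ⟩) e + (tail₀ f · g) (x ∷ e)
      ≡⟨ cong₂ _+_ (·-comm (f ⟨ 0 ⟩) (g ⟨ suc x ⟩) e) (·-comm (tail₀ f) g (x ∷ e)) ⟩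
    (g ⟨ suc x ⟩ · f ⟨ 0 ⟩) e + (g · tail₀ f) (x ∷ e)
      ≡⟨ +-comm ((g ⟨ suc x ⟩ · f ⟨ 0 ⟩) e) _ ⟩
    (g · tail₀ f) (x ∷ e) + (g ⟨ suc x ⟩ · f ⟨ 0 ⟩) e
      ≡⟨ sym (·-sucʳ g f x e) ⟩
    _ ∎

  ·-distribʳ : ∀ (h f g : PS n) → ((f ⊕ g) · h) ≈ ((f · h) ⊕ (g · h))
  ·-distribʳ h f g [] = begin
    ((f ⊕ g) · h) []           ≡⟨ ·-[] (f ⊕ g) h ⟩
    (f [] + g []) * h []       ≡⟨ *-distribʳ-+ (h []) (f []) (g []) ⟩
    f [] * h [] + g [] * h []  ≡⟨ sym (cong₂ _+_ (·-[] f h) (·-[] g h)) ⟩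
    _ ∎
  ·-distribʳ h f g (zero ∷ e) = begin
    ((f ⊕ g) · h) (0 ∷ e)                            ≡⟨ ·-zero (f ⊕ g) h e ⟩
    ((f ⟨ 0 ⟩ ⊕ g ⟨ 0 ⟩) · h ⟨ 0 ⟩) e                ≡⟨ ·-distribʳ (h ⟨ 0 ⟩) (f ⟨ 0 ⟩) (g ⟨ 0 ⟩) e ⟩
    (f ⟨ 0 ⟩ · h ⟨ 0 ⟩) e + (g ⟨ 0 ⟩ · h ⟨ 0 ⟩) e    ≡⟨ sym (cong₂ _+_ (·-zero f h e) (·-zero g h e)) ⟩
    _ ∎
  ·-distribʳ h f g (suc x ∷ e) = begin
    ((f ⊕ g) · h) (suc x ∷ e)
      ≡⟨ ·-suc (f ⊕ g) h x e ⟩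
    ((f ⟨ 0 ⟩ ⊕ g ⟨ 0 ⟩) · h ⟨ suc x ⟩) e + (tail₀ (f ⊕ g) · h) (x ∷ e)
      ≡⟨ cong₂ _+_ (·-distribʳ (h ⟨ suc x ⟩) (f ⟨ 0 ⟩) (g ⟨ 0 ⟩) e)
           (trans (·-cong {f = tail₀ (f ⊕ g)} {f′ = tail₀ f ⊕ tail₀ g} {g = h} (λ { (_ ∷ _) → refl }) (λ _ → refl) (x ∷ e))
                  (·-distribʳ h (tail₀ f) (tail₀ g) (x ∷ e))) ⟩
    ((f ⟨ 0 ⟩ · h ⟨ suc x ⟩) e + (g ⟨ 0 ⟩ · h ⟨ suc x ⟩) e)
      + ((tail₀ f · h) (x ∷ e) + (tail₀ g · h) (x ∷ e))
      ≡⟨ interchange ((f ⟨ 0 ⟩ · h ⟨ suc x ⟩) e) ((g ⟨ 0 ⟩ · h ⟨ suc x ⟩) e) ((tail₀ f · h) (x ∷ e)) ((tail₀ g · h) (x ∷ e)) ⟩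
    ((f ⟨ 0 ⟩ · h ⟨ suc x ⟩) e + (tail₀ f · h) (x ∷ e))
      + ((g ⟨ 0 ⟩ · h ⟨ suc x ⟩) e + (tail₀ g · h) (x ∷ e))
      ≡⟨ sym (cong₂ _+_ (·-suc f h x e) (·-suc g h x e)) ⟩
    _ ∎
    where
    interchange : ∀ a b c d → (a + b) + (c + d) ≡ (a + c) + (b + d)
    interchange = solve-∀

  ·-distribˡ : ∀ (h f g : PS n) → (h · (f ⊕ g)) ≈ ((h · f) ⊕ (h · g))
  ·-distribˡ h f g e = trans (·-comm h (f ⊕ g) e)
    (trans (·-distribʳ h f g e) (cong₂ _+_ (·-comm f h e) (·-comm g h e)))

  -- Multiplication by a series free of X₀. The coefficients of `tail₀ (f · g)` contain such a
  -- multiple of `tail₀ g`, with the slice `f ⟨ 0 ⟩` as multiplier.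
  scale₀ : PS n → PS (suc n) → PS (suc n)
  scale₀ c f (x ∷ e) = (c · f ⟨ x ⟩) e

  tail₀-· : ∀ (f g : PS (suc n)) → tail₀ (f · g) ≈ (scale₀ (f ⟨ 0 ⟩) (tail₀ g) ⊕ (tail₀ f · g))
  tail₀-· f g (x ∷ e) = ·-suc f g x e

  -- Mutual with `scale₀-·`: expanding `tail₀ (f · g)` produces a scaled factor, and moving the
  -- scalar out of a product is associativity in one variable fewer.
  ·-assoc : ∀ (f g h : PS n) → ((f · g) · h) ≈ (f · (g · h))

  scale₀-· : ∀ (c : PS n) (f g : PS (suc n)) → (scale₀ c f · g) ≈ scale₀ c (f · g)
  scale₀-· c f g (zero ∷ e) = begin
    (scale₀ c f · g) (0 ∷ e)         ≡⟨ ·-zero (scale₀ c f) g e ⟩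
    ((c · f ⟨ 0 ⟩) · g ⟨ 0 ⟩) e      ≡⟨ ·-assoc c (f ⟨ 0 ⟩) (g ⟨ 0 ⟩) e ⟩
    (c · (f ⟨ 0 ⟩ · g ⟨ 0 ⟩)) e      ≡⟨ ·-cong {f = c} (λ _ → refl) (λ e′ → sym (·-zero f g e′)) e ⟩
    _ ∎
  scale₀-· c f g (suc x ∷ e) = begin
    (scale₀ c f · g) (suc x ∷ e)
      ≡⟨ ·-suc (scale₀ c f) g x e ⟩
    ((c · f ⟨ 0 ⟩) · g ⟨ suc x ⟩) e + (tail₀ (scale₀ c f) · g) (x ∷ e)
      ≡⟨ cong₂ _+_ (·-assoc c (f ⟨ 0 ⟩) (g ⟨ suc x ⟩) e)
           (trans (·-cong {f = tail₀ (scale₀ c f)} {f′ = scale₀ c (tail₀ f)} {g = g} (λ { (_ ∷ _) → refl }) (λ _ → refl) (x ∷ e))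
                  (scale₀-· c (tail₀ f) g (x ∷ e))) ⟩
    (c · (f ⟨ 0 ⟩ · g ⟨ suc x ⟩)) e + (c · (tail₀ f · g) ⟨ x ⟩) e
      ≡⟨ sym (·-distribˡ c (f ⟨ 0 ⟩ · g ⟨ suc x ⟩) ((tail₀ f · g) ⟨ x ⟩) e) ⟩
    (c · ((f ⟨ 0 ⟩ · g ⟨ suc x ⟩) ⊕ (tail₀ f · g) ⟨ x ⟩)) e
      ≡⟨ ·-cong {f = c} (λ _ → refl) (λ e′ → sym (·-suc f g x e′)) e ⟩
    _ ∎

  ·-assoc f g h [] = begin
    ((f · g) · h) []          ≡⟨ ·-[] (f · g) h ⟩
    (f · g) [] * h []         ≡⟨ cong (_* h []) (·-[] f g) ⟩
    f [] * g [] * h []        ≡⟨ *-assoc (f []) (g []) (h []) ⟩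
    f [] * (g [] * h [])      ≡⟨ cong (f [] *_) (sym (·-[] g h)) ⟩
    f [] * (g · h) []         ≡⟨ sym (·-[] f (g · h)) ⟩
    _ ∎
  ·-assoc f g h (zero ∷ e) = begin
    ((f · g) · h) (0 ∷ e)                   ≡⟨ ·-zero (f · g) h e ⟩
    ((f · g) ⟨ 0 ⟩ · h ⟨ 0 ⟩) e             ≡⟨ ·-cong {g = h ⟨ 0 ⟩} (·-zero f g) (λ _ → refl) e ⟩
    ((f ⟨ 0 ⟩ · g ⟨ 0 ⟩) · h ⟨ 0 ⟩) e       ≡⟨ ·-assoc (f ⟨ 0 ⟩) (g ⟨ 0 ⟩) (h ⟨ 0 ⟩) e ⟩
    (f ⟨ 0 ⟩ · (g ⟨ 0 ⟩ · h ⟨ 0 ⟩)) e       ≡⟨ ·-cong {f = f ⟨ 0 ⟩} (λ _ → refl) (λ e′ → sym (·-zero g h e′)) e ⟩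
    (f ⟨ 0 ⟩ · (g · h) ⟨ 0 ⟩) e             ≡⟨ sym (·-zero f (g · h) e) ⟩
    _ ∎
  ·-assoc f g h (suc x ∷ e) = begin
    ((f · g) · h) (suc x ∷ e)
      ≡⟨ ·-suc (f · g) h x e ⟩
    ((f · g) ⟨ 0 ⟩ · h ⟨ suc x ⟩) e + (tail₀ (f · g) · h) (x ∷ e)
      ≡⟨ cong₂ _+_ (·-cong {g = h ⟨ suc x ⟩} (·-zero f g) (λ _ → refl) e)
                   (·-cong {g = h} (tail₀-· f g) (λ _ → refl) (x ∷ e)) ⟩
    ((f ⟨ 0 ⟩ · g ⟨ 0 ⟩) · h ⟨ suc x ⟩) e
      + ((scale₀ (f ⟨ 0 ⟩) (tail₀ g) ⊕ (tail₀ f · g)) · h) (x ∷ e)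
      ≡⟨ cong₂ _+_ (·-assoc (f ⟨ 0 ⟩) (g ⟨ 0 ⟩) (h ⟨ suc x ⟩) e)
                   (·-distribʳ h (scale₀ (f ⟨ 0 ⟩) (tail₀ g)) (tail₀ f · g) (x ∷ e)) ⟩
    (f ⟨ 0 ⟩ · (g ⟨ 0 ⟩ · h ⟨ suc x ⟩)) e
      + ((scale₀ (f ⟨ 0 ⟩) (tail₀ g) · h) (x ∷ e) + ((tail₀ f · g) · h) (x ∷ e))
      ≡⟨ cong (λ s → (f ⟨ 0 ⟩ · (g ⟨ 0 ⟩ · h ⟨ suc x ⟩)) e + s)
           (cong₂ _+_ (scale₀-· (f ⟨ 0 ⟩) (tail₀ g) h (x ∷ e)) (·-assoc (tail₀ f) g h (x ∷ e))) ⟩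
    (f ⟨ 0 ⟩ · (g ⟨ 0 ⟩ · h ⟨ suc x ⟩)) e
      + ((f ⟨ 0 ⟩ · (tail₀ g · h) ⟨ x ⟩) e + (tail₀ f · (g · h)) (x ∷ e))
      ≡⟨ sym (+-assoc ((f ⟨ 0 ⟩ · (g ⟨ 0 ⟩ · h ⟨ suc x ⟩)) e) _ _) ⟩
    ((f ⟨ 0 ⟩ · (g ⟨ 0 ⟩ · h ⟨ suc x ⟩)) e + (f ⟨ 0 ⟩ · (tail₀ g · h) ⟨ x ⟩) e)
      + (tail₀ f · (g · h)) (x ∷ e)
      ≡⟨ cong (_+ (tail₀ f · (g · h)) (x ∷ e))
           (sym (·-distribˡ (f ⟨ 0 ⟩) (g ⟨ 0 ⟩ · h ⟨ suc x ⟩) ((tail₀ g · h) ⟨ x ⟩) e)) ⟩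
    (f ⟨ 0 ⟩ · ((g ⟨ 0 ⟩ · h ⟨ suc x ⟩) ⊕ (tail₀ g · h) ⟨ x ⟩)) e + (tail₀ f · (g · h)) (x ∷ e)
      ≡⟨ cong (_+ (tail₀ f · (g · h)) (x ∷ e))
           (·-cong {f = f ⟨ 0 ⟩} (λ _ → refl) (λ e′ → sym (·-suc g h x e′)) e) ⟩
    (f ⟨ 0 ⟩ · (g · h) ⟨ suc x ⟩) e + (tail₀ f · (g · h)) (x ∷ e)
      ≡⟨ sym (·-suc f (g · h) x e) ⟩
    _ ∎

  -- Coefficients of constants, variables and geometric series

  const-zero : ∀ c (e : Vec ℕ n) → const c (0 ∷ e) ≡ const c e
  const-zero {n} c e with Vec.≡-dec ℕ._≟_ (0 ∷ e) (replicate (suc n) 0) | Vec.≡-dec ℕ._≟_ e (replicate n 0)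
  ... | yes _  | yes _  = refl
  ... | no _   | no _   = refl
  ... | yes p  | no q   = contradiction (Vec.∷-injectiveʳ p) q
  ... | no p   | yes q  = contradiction (cong (0 ∷_) q) p

  const-suc : ∀ c x (e : Vec ℕ n) → const c (suc x ∷ e) ≡ 0ℤ
  const-suc {n} c x e with Vec.≡-dec ℕ._≟_ (suc x ∷ e) (replicate (suc n) 0)
  ... | no _ = refl

  var₀-zero : ∀ (e : Vec ℕ n) → var zero (0 ∷ e) ≡ 0ℤ
  var₀-zero {n} e with Vec.≡-dec ℕ._≟_ (0 ∷ e) (replicate (suc n) 0 [ zero ]≔ 1)
  ... | no _ = refl

  var₀-one : ∀ (e : Vec ℕ n) → var zero (1 ∷ e) ≡ const 1ℤ e
  var₀-one {n} e with Vec.≡-dec ℕ._≟_ (1 ∷ e) (replicate (suc n) 0 [ zero ]≔ 1) | Vec.≡-dec ℕ._≟_ e (replicate n 0)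
  ... | yes _  | yes _  = refl
  ... | no _   | no _   = refl
  ... | yes p  | no q   = contradiction (Vec.∷-injectiveʳ p) q
  ... | no p   | yes q  = contradiction (cong (1 ∷_) q) p

  var₀-suc : ∀ x (e : Vec ℕ n) → var zero (suc (suc x) ∷ e) ≡ 0ℤ
  var₀-suc {n} x e with Vec.≡-dec ℕ._≟_ (suc (suc x) ∷ e) (replicate (suc n) 0 [ zero ]≔ 1)
  ... | no _ = refl

  varₛ-zero : ∀ (i : Fin n) e → var (suc i) (0 ∷ e) ≡ var i e
  varₛ-zero {n} i e with Vec.≡-dec ℕ._≟_ (0 ∷ e) (replicate (suc n) 0 [ suc i ]≔ 1) | Vec.≡-dec ℕ._≟_ e (replicate n 0 [ i ]≔ 1)
  ... | yes _  | yes _  = refl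
  ... | no _   | no _   = refl
  ... | yes p  | no q   = contradiction (Vec.∷-injectiveʳ p) q
  ... | no p   | yes q  = contradiction (cong (0 ∷_) q) p

  varₛ-suc : ∀ (i : Fin n) x e → var (suc i) (suc x ∷ e) ≡ 0ℤ
  varₛ-suc {n} i x e with Vec.≡-dec ℕ._≟_ (suc x ∷ e) (replicate (suc n) 0 [ suc i ]≔ 1)
  ... | no _ = refl

  geom₀ : ∀ x (e : Vec ℕ n) → geom zero (x ∷ e) ≡ const 1ℤ e
  geom₀ {n} x e with x ℕ.≟ x
  ... | no x≢x = contradiction refl x≢x
  ... | yes _ with Vec.≡-dec ℕ._≟_ e (replicate n 0)
  ...   | yes _ = refl
  ...   | no _  = refl

  geomₛ-zero : ∀ (i : Fin n) e → geom (suc i) (0 ∷ e) ≡ geom i e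
  geomₛ-zero {n} i e with Vec.≡-dec ℕ._≟_ (0 ∷ e) (replicate (suc n) 0 [ suc i ]≔ lookup e i) | Vec.≡-dec ℕ._≟_ e (replicate n 0 [ i ]≔ lookup e i)
  ... | yes _  | yes _  = refl
  ... | no _   | no _   = refl
  ... | yes p  | no q   = contradiction (Vec.∷-injectiveʳ p) q
  ... | no p   | yes q  = contradiction (cong (0 ∷_) q) p

  geomₛ-suc : ∀ (i : Fin n) x e → geom (suc i) (suc x ∷ e) ≡ 0ℤ
  geomₛ-suc {n} i x e with Vec.≡-dec ℕ._≟_ (suc x ∷ e) (replicate (suc n) 0 [ suc i ]≔ lookup e i)
  ... | no _ = refl

  -- Opaque copies of the series operations: they do not unfold to coefficients, so
  -- that unification can read off their arguments.
  infixl 6 _⊞_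
  infix 8 ⊟_
  opaque
    _⊞_ : PS n → PS n → PS n
    _⊞_ = _⊕_

    ⊟_ : PS n → PS n
    (⊟ f) e = - f e

    𝟘 : PS n
    𝟘 e = 0ℤ

    constant : ℤ → PS n
    constant = const

    ⊞-at : ∀ (f g : PS n) e → (f ⊞ g) e ≡ f e + g e
    ⊞-at f g e = refl

    neg-at : ∀ (f : PS n) e → (⊟ f) e ≡ - f e
    neg-at f e = refl

    constant-at : ∀ c (e : Vec ℕ n) → constant c e ≡ const c e
    constant-at c e = refl

  𝟙 : PS n
  𝟙 = constant 1ℤ

  zero-· : ∀ (f : PS n) e → ((λ _ → 0ℤ) · f) e ≡ 0ℤ
  zero-· f []          = trans (·-[] (λ _ → 0ℤ) f) (*-zeroˡ (f []))
  zero-· f (zero ∷ e)  = trans (·-zero (λ _ → 0ℤ) f e) (zero-· (f ⟨ 0 ⟩) e)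
  zero-· f (suc x ∷ e) = trans (·-suc (λ _ → 0ℤ) f x e)
    (cong₂ _+_ (zero-· (f ⟨ suc x ⟩) e)
      (trans (·-cong {f = tail₀ (λ _ → 0ℤ)} {g = f} (λ { (_ ∷ _) → refl }) (λ _ → refl) (x ∷ e)) (zero-· f (x ∷ e))))

  -- A series without X₀ multiplies every X₀-slice separately. This reduces products with `const c`
  -- and `var (suc i)` to one variable fewer.
  constant-in-first-· : ∀ {f : PS (suc n)} {h : PS n} → f ⟨ 0 ⟩ ≈ h → (∀ x e → f (suc x ∷ e) ≡ 0ℤ) →
    ∀ g x e → (f · g) (x ∷ e) ≡ (h · g ⟨ x ⟩) e
  constant-in-first-· {f = f} p q g zero e = trans (·-zero f g e) (·-cong {g = g ⟨ 0 ⟩} p (λ _ → refl) e)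
  constant-in-first-· {f = f} {h} p q g (suc x) e = begin
    (f · g) (suc x ∷ e)
      ≡⟨ ·-suc f g x e ⟩
    (f ⟨ 0 ⟩ · g ⟨ suc x ⟩) e + (tail₀ f · g) (x ∷ e)
      ≡⟨ cong₂ _+_ (·-cong {g = g ⟨ suc x ⟩} p (λ _ → refl) e)
           (·-cong {f = tail₀ f} {f′ = λ _ → 0ℤ} {g = g} (λ { (x ∷ e) → q x e }) (λ _ → refl) (x ∷ e)) ⟩
    (h · g ⟨ suc x ⟩) e + ((λ _ → 0ℤ) · g) (x ∷ e)
      ≡⟨ cong ((h · g ⟨ suc x ⟩) e +_) (zero-· g (x ∷ e)) ⟩
    (h · g ⟨ suc x ⟩) e + 0ℤ
      ≡⟨ +-identityʳ _ ⟩
    (h · g ⟨ suc x ⟩) e ∎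

  const-· : ∀ c (f : PS n) e → (const c · f) e ≡ c * f e
  const-· c f []      = ·-[] (const c) f
  const-· c f (x ∷ e) = trans (constant-in-first-· (const-zero c) (const-suc c) f x e) (const-· c (f ⟨ x ⟩) e)

  const-scale : ∀ a b (e : Vec ℕ n) → a * const b e ≡ const (a * b) e
  const-scale {n} a b e with Vec.≡-dec ℕ._≟_ e (replicate n 0)
  ... | yes _ = refl
  ... | no _  = *-zeroʳ a

  const-+ : ∀ a b (e : Vec ℕ n) → const (a + b) e ≡ const a e + const b e
  const-+ {n} a b e with Vec.≡-dec ℕ._≟_ e (replicate n 0)
  ... | yes _ = refl
  ... | no _  = refl

  const-neg : ∀ a (e : Vec ℕ n) → const (- a) e ≡ - const a e
  const-neg {n} a e with Vec.≡-dec ℕ._≟_ e (replicate n 0)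
  ... | yes _ = refl
  ... | no _  = refl

  const-0 : ∀ (e : Vec ℕ n) → const 0ℤ e ≡ 0ℤ
  const-0 {n} e with Vec.≡-dec ℕ._≟_ e (replicate n 0)
  ... | yes _ = refl
  ... | no _  = refl

  opaque
    unfolding _⊞_

    psIsCommutativeRing : IsCommutativeRing (_≈_ {n}) _⊞_ _·_ ⊟_ 𝟘 𝟙
    psIsCommutativeRing {n} = record
      { isRing = record
        { +-isAbelianGroup = record
          { isGroup = record
            { isMonoid = record
              { isSemigroup = record
                { isMagma = record
                  { isEquivalence = record
                    { refl  = λ _ → refl
                    ; sym   = λ p e → sym (p e)
                    ; trans = λ p q e → trans (p e) (q e)
                    }
                  ; ∙-cong = λ p q e → cong₂ _+_ (p e) (q e)
                  }
                ; assoc = λ f g h e → +-assoc (f e) (g e) (h e)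
                }
              ; identity = (λ f e → +-identityˡ (f e)) , (λ f e → +-identityʳ (f e))
              }
            ; inverse = (λ f e → +-inverseˡ (f e)) , (λ f e → +-inverseʳ (f e))
            ; ⁻¹-cong = λ p e → cong -_ (p e)
            }
          ; comm = λ f g e → +-comm (f e) (g e)
          }
        ; *-cong = ·-cong
        ; *-assoc = ·-assoc
        ; *-identity = 𝟙-· , λ f e → trans (·-comm f 𝟙 e) (𝟙-· f e)
        ; distrib = ·-distribˡ , ·-distribʳ
        }
      ; *-comm = ·-comm
      }
      where
      𝟙-· : ∀ (f : PS n) → 𝟙 · f ≈ f
      𝟙-· f e = trans (const-· 1ℤ f e) (*-identityˡ (f e))

  psRing : ℕ → CommutativeRing 0ℓ 0ℓ
  psRing n = record { isCommutativeRing = psIsCommutativeRing {n} }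

  opaque
    unfolding _⊞_

    constant-+ : ∀ a b → constant {n} (a + b) ≈ constant a ⊞ constant b
    constant-+ = const-+

    constant-* : ∀ a b → constant {n} (a * b) ≈ constant a · constant b
    constant-* a b e = sym (trans (const-· a (const b) e) (const-scale a b e))

    constant-neg : ∀ a → constant {n} (- a) ≈ ⊟ constant a
    constant-neg = const-neg

    constant-0 : constant {n} 0ℤ ≈ 𝟘
    constant-0 = const-0

  constant-morphism : ACR._-Raw-AlmostCommutative⟶_ (CommutativeRing.rawRing +-*-commutativeRing)
                        (ACR.fromCommutativeRing (psRing n))
  constant-morphism = record
    { ⟦_⟧    = constant
    ; +-homo = constant-+
    ; *-homo = constant-*
    ; -‿homo = constant-neg
    ; 0-homo = constant-0
    ; 1-homo = λ _ → refl
    }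

  constant-≟ : ∀ a b → Maybe (constant {n} a ≈ constant b)
  constant-≟ a b with a ℤ.≟ b
  ... | yes refl = just λ _ → refl
  ... | no _     = nothing

  module PSSolver (n : ℕ) = RingSolver _ (ACR.fromCommutativeRing (psRing n)) constant-morphism constant-≟

-- An alternating expansion of the Vandermonde product

module Vandermonde where
  open import Algebra.Bundles using (CommutativeRing)
  import Algebra.Properties.CommutativeMonoid.Sum as Sum
  import Algebra.Properties.CommutativeSemiring.Exp as Exp
  import Relation.Binary.Reasoning.Setoid as SetoidReasoning
  open PowerSeriesRing

  module PSR {n : ℕ} where
    open CommutativeRing (psRing n) public
      using (refl; sym; trans; +-cong; +-congˡ; +-congʳ; *-cong; *-congˡ; *-congʳ; -‿cong; *-assoc; *-comm; *-identityˡ; *-identityʳ)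
    open Sum (CommutativeRing.*-commutativeMonoid (psRing n)) public
      using ()
      renaming (sum to Π; sum-cong-≋ to Π-cong; sum-remove to Π-remove; ∑-distrib-+ to Π-distrib-·)
    open Exp (CommutativeRing.commutativeSemiring (psRing n)) public
      using (_^_; ^-congˡ; ^-distrib-*)
    open SetoidReasoning (CommutativeRing.setoid (psRing n)) public
      using (begin_; _∎; step-≈-⟩; step-≈-⟨)
  open PSR

  infixl 6 _⊟_
  _⊟_ : PS n → PS n → PS n
  f ⊟ g = f ⊞ ⊟ g

  Alt : (Fin (suc k) → PS n) → PS n
  Alt {zero}  t = t zero
  Alt {suc k} t = t zero ⊟ Alt (t ∘ suc)

  pairProduct : (Fin k → Fin k → PS n) → PS n
  pairProduct {zero}  φ = 𝟙
  pairProduct {suc k} φ = Π (φ zero ∘ suc) · pairProduct (λ i j → φ (suc i) (suc j))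

  vandermonde : (Fin k → PS n) → PS n
  vandermonde x = pairProduct (λ i j → x j ⊟ x i)

  Alt-cong : {s t : Fin (suc k) → PS n} → (∀ r → s r ≈ t r) → Alt s ≈ Alt t
  Alt-cong {zero}  p = p zero
  Alt-cong {suc k} p = +-cong (p zero) (-‿cong (Alt-cong (p ∘ suc)))

  Alt-linear : ∀ (u v : PS n) (s t : Fin (suc k) → PS n) →
    Alt (λ r → u · s r ⊟ v · t r) ≈ u · Alt s ⊟ v · Alt t
  Alt-linear {k = zero} u v s t = refl
  Alt-linear {n} {suc k} u v s t = begin
    u · s zero ⊟ v · t zero ⊟ Alt (λ r → u · s (suc r) ⊟ v · t (suc r))
      ≈⟨ +-congˡ (-‿cong (Alt-linear u v (s ∘ suc) (t ∘ suc))) ⟩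
    u · s zero ⊟ v · t zero ⊟ (u · Alt (s ∘ suc) ⊟ v · Alt (t ∘ suc))
      ≈⟨ solve 6 (λ u v s t S T → u :* s :- v :* t :- (u :* S :- v :* T) := u :* (s :- S) :- v :* (t :- T)) refl
           u v (s zero) (t zero) (Alt (s ∘ suc)) (Alt (t ∘ suc)) ⟩
    u · (s zero ⊟ Alt (s ∘ suc)) ⊟ v · (t zero ⊟ Alt (t ∘ suc)) ∎
    where open PSSolver n using (solve; con; _:=_; _:+_; _:*_; _:-_; :-_)

  private
    -- This holds whenever c_j = α x_j + β with l = α + β, so that l is the value at 1 of the affine
    -- function c. The instance of interest is c = x with l = 1, but the induction also needs c = x
    -- - x₀ with l = 1 - x₀.
    Compatible : (x c : Fin k → PS n) → PS n → Set
    Compatible x c l = ∀ i j → (𝟙 ⊟ x i) · c j ⊟ (𝟙 ⊟ x j) · c i ≈ l · (x j ⊟ x i)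

    -- Up to the signs supplied by `Alt`, these are the terms of a Laplace expansion along the first
    -- row. The determinant has a column for each point x_i, and its rows are the values of (1 -
    -- x)^k, c, c x, ..., c x^(k-1).
    minor : (x c : Fin (suc k) → PS n) → Fin (suc k) → PS n
    minor {k} x c r = (𝟙 ⊟ x r) ^ k · Π (c ∘ punchIn r) · vandermonde (x ∘ punchIn r)

  differences-compatible : ∀ (x : Fin (suc k) → PS n) → Compatible (x ∘ suc) (λ j → x (suc j) ⊟ x zero) (𝟙 ⊟ x zero)
  differences-compatible {n = n} x i j =
    solve 3 (λ a b c → (con 1ℤ :- b) :* (c :- a) :- (con 1ℤ :- c) :* (b :- a) := (con 1ℤ :- a) :* (c :- b)) refl
      (x zero) (x (suc i)) (x (suc j))
    where open PSSolver n using (solve; con; _:=_; _:+_; _:*_; _:-_; :-_)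

  -- Since a_r c_0 = a_0 c_r - l (x_r - x_0) for a = 1 - x, each later minor splits into minors of the remaining
  -- points for the families c and x - x_0, to both of which the induction hypothesis applies.
  vandermonde-expansion : ∀ (x c : Fin (suc k) → PS n) l → Compatible x c l →
    Alt (minor x c) ≈ l ^ k · vandermonde x
  vandermonde-expansion {zero} {n} x c l comp = solve 0 (con 1ℤ :* con 1ℤ :* con 1ℤ := con 1ℤ :* (con 1ℤ :* con 1ℤ)) refl
    where open PSSolver n using (solve; con; _:=_; _:+_; _:*_; _:-_; :-_)
  vandermonde-expansion {suc k} {n} x c l comp = begin
    Alt (minor x c)
      ≈⟨ +-congˡ (-‿cong (Alt-cong step)) ⟩
    a · a ^ k · Πc · W ⊟ Alt (λ r → (a · Πc) · minor x′ d r ⊟ (l · Πd) · minor x′ c′ r)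
      ≈⟨ +-congˡ (-‿cong (Alt-linear (a · Πc) (l · Πd) (minor x′ d) (minor x′ c′))) ⟩
    a · a ^ k · Πc · W ⊟ ((a · Πc) · Alt (minor x′ d) ⊟ (l · Πd) · Alt (minor x′ c′))
      ≈⟨ +-congˡ (-‿cong (+-cong
           (*-congˡ (vandermonde-expansion x′ d a (differences-compatible x)))
           (-‿cong (*-congˡ (vandermonde-expansion x′ c′ l (λ i j → comp (suc i) (suc j))))))) ⟩
    a · a ^ k · Πc · W ⊟ ((a · Πc) · (a ^ k · W) ⊟ (l · Πd) · (l ^ k · W))
      ≈⟨ solve 7 (λ a A C W l D L → a :* A :* C :* W :- (a :* C :* (A :* W) :- l :* D :* (L :* W)) := l :* L :* (D :* W)) refl
           a (a ^ k) Πc W l Πd (l ^ k) ⟩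
    l · l ^ k · (Πd · W) ∎
    where
    open PSSolver n using (solve; con; _:=_; _:+_; _:*_; _:-_; :-_)
    x′ c′ d : Fin (suc k) → PS n
    x′ = x ∘ suc
    c′ = c ∘ suc
    d j = x (suc j) ⊟ x zero
    a Πc Πd W : PS n
    a = 𝟙 ⊟ x zero
    Πc = Π c′
    Πd = Π d
    W = vandermonde x′
    step : ∀ r → minor x c (suc r) ≈ (a · Πc) · minor x′ d r ⊟ (l · Πd) · minor x′ c′ r
    step r = begin
      b · B · (c zero · C) · (D · V)
        ≈⟨ solve 6 (λ b B c₀ C D V → b :* B :* (c₀ :* C) :* (D :* V) := (b :* c₀) :* (B :* C :* D :* V)) refl
             b B (c zero) C D V ⟩
      (b · c zero) · (B · C · D · V)
        ≈⟨ *-congʳ (begin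
             b · c zero
               ≈⟨ solve 4 (λ a b c₀ c′ → b :* c₀ := a :* c′ :- (a :* c′ :- b :* c₀)) refl a b (c zero) (c′ r) ⟩
             a · c′ r ⊟ (a · c′ r ⊟ b · c zero)
               ≈⟨ +-congˡ (-‿cong (comp zero (suc r))) ⟩
             a · c′ r ⊟ l · d r ∎) ⟩
      (a · c′ r ⊟ l · d r) · (B · C · D · V)
        ≈⟨ solve 8 (λ a c l d B C D V → (a :* c :- l :* d) :* (B :* C :* D :* V)
                        := a :* (c :* C) :* (B :* D :* V) :- l :* (d :* D) :* (B :* C :* V)) refl
             a (c′ r) l (d r) B C D V ⟩
      (a · (c′ r · C)) · (B · D · V) ⊟ (l · (d r · D)) · (B · C · V)
        ≈⟨ +-cong (*-congʳ (*-congˡ (sym (Π-remove {i = r} c′))))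
                  (-‿cong (*-congʳ (*-congˡ (sym (Π-remove {i = r} d))))) ⟩
      (a · Πc) · (B · D · V) ⊟ (l · Πd) · (B · C · V) ∎
      where
      b B C D V : PS n
      b = 𝟙 ⊟ x′ r
      B = b ^ k
      C = Π (c′ ∘ punchIn r)
      D = Π (d ∘ punchIn r)
      V = vandermonde (x′ ∘ punchIn r)

-- Relabelling of variables; the series `D` and `G`

module Substitutions where
  open import Relation.Binary.PropositionalEquality as ≡ using (_≡_)
  open PowerSeriesRing
  open Vandermonde
  open PSR

  var₀-·-zero : ∀ (f : PS (suc n)) e → (var zero · f) (0 ∷ e) ≡ 0ℤ
  var₀-·-zero f e = ≡.trans (·-zero (var zero) f e)
    (≡.trans (·-cong {g = f ⟨ 0 ⟩} var₀-zero refl e) (zero-· (f ⟨ 0 ⟩) e))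

  var₀-·-suc : ∀ (f : PS (suc n)) x e → (var zero · f) (suc x ∷ e) ≡ f (x ∷ e)
  var₀-·-suc f x e = ≡.trans (·-suc (var zero) f x e)
    (≡.trans (≡.cong₂ ℤ._+_
        (≡.trans (·-cong {g = f ⟨ suc x ⟩} var₀-zero refl e) (zero-· (f ⟨ suc x ⟩) e))
        (≡.trans (constant-in-first-· {h = const 1ℤ} var₀-one var₀-suc f x e) (const-· 1ℤ (f ⟨ x ⟩) e)))
      (≡.trans (ℤ.+-identityˡ _) (ℤ.*-identityˡ (f (x ∷ e)))))

  varₛ-· : ∀ (i : Fin n) f x e → (var (suc i) · f) (x ∷ e) ≡ (var i · f ⟨ x ⟩) e
  varₛ-· i = constant-in-first-· (varₛ-zero i) (varₛ-suc i)

  geom-unfold : ∀ (i : Fin n) → geom i ≈ 𝟙 ⊞ var i · geom i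
  geom-unfold i e = ≡.trans (at i e) (≡.sym (≡.trans (⊞-at 𝟙 (var i · geom i) e)
      (≡.cong (ℤ._+ (var i · geom i) e) (constant-at 1ℤ e))))
    where
    at : ∀ {n} (i : Fin n) e → geom i e ≡ const 1ℤ e ℤ.+ (var i · geom i) e
    at zero (zero ∷ e) = ≡.trans (geom₀ 0 e) (≡.sym (≡.trans
      (≡.cong₂ ℤ._+_ (const-zero 1ℤ e) (var₀-·-zero (geom zero) e)) (ℤ.+-identityʳ _)))
    at zero (suc x ∷ e) = ≡.trans (geom₀ (suc x) e) (≡.sym (≡.trans
      (≡.cong₂ ℤ._+_ (const-suc 1ℤ x e) (≡.trans (var₀-·-suc (geom zero) x e) (geom₀ x e))) (ℤ.+-identityˡ _)))
    at (suc i) (zero ∷ e) = ≡.trans (geomₛ-zero i e) (≡.trans (at i e)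
      (≡.sym (≡.cong₂ ℤ._+_ (const-zero 1ℤ e)
        (≡.trans (varₛ-· i (geom (suc i)) 0 e) (·-cong {f = var i} refl (geomₛ-zero i) e)))))
    at (suc i) (suc x ∷ e) = ≡.trans (geomₛ-suc i x e) (≡.sym
      (≡.cong₂ ℤ._+_ (const-suc 1ℤ x e)
        (≡.trans (varₛ-· i (geom (suc i)) (suc x) e)
          (≡.trans (·-cong {f = var i} refl (geomₛ-suc i x) e)
            (≡.trans (·-comm (var i) (λ _ → 0ℤ) e) (zero-· (var i) e))))))

  geom-inverse : ∀ (i : Fin n) → geom i · (𝟙 ⊟ var i) ≈ 𝟙
  geom-inverse {n} i = begin
    geom i · (𝟙 ⊟ var i)
      ≈⟨ solve 2 (λ g x → g :* (con 1ℤ :- x) := g :- x :* g) refl (geom i) (var i) ⟩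
    geom i ⊟ var i · geom i
      ≈⟨ +-congʳ (geom-unfold i) ⟩
    𝟙 ⊞ var i · geom i ⊟ var i · geom i
      ≈⟨ solve 1 (λ y → con 1ℤ :+ y :- y := con 1ℤ) refl (var i · geom i) ⟩
    𝟙 ∎
    where open PSSolver n using (solve; con; _:=_; _:+_; _:*_; _:-_; :-_)

  -- Multiplication by a polynomial in the variables can be pushed through T when T
  -- relabels the variables along ρ; since 1 - Xᵢ is invertible, so can the geometric series.
  record Semilinear (σ : Fin k → Fin n) (ρ : Fin k → Fin m) : Set where
    field
      T      : PS n → PS m
      T-cong : ∀ {f g} → f ≈ g → T f ≈ T g
      T-⊟    : ∀ f g → T (f ⊟ g) ≈ T f ⊟ T g
      T-var  : ∀ i f → T (var (σ i) · f) ≈ var (ρ i) · T f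

  module _ {σ : Fin k → Fin n} {ρ : Fin k → Fin m} (S : Semilinear σ ρ) where
    open Semilinear S

    Tracks : PS m → PS n → Set
    Tracks a b = ∀ f → a · T f ≈ T (b · f)

    Tracks-var : ∀ i → Tracks (var (ρ i)) (var (σ i))
    Tracks-var i f = sym (T-var i f)

    Tracks-𝟙 : Tracks 𝟙 𝟙
    Tracks-𝟙 f = trans (*-identityˡ (T f)) (T-cong (sym (*-identityˡ f)))

    Tracks-· : ∀ {a b a′ b′} → Tracks a b → Tracks a′ b′ → Tracks (a · a′) (b · b′)
    Tracks-· {a} {b} {a′} {b′} p q f = begin
      a · a′ · T f     ≈⟨ *-assoc a a′ (T f) ⟩
      a · (a′ · T f)   ≈⟨ *-congˡ (q f) ⟩
      a · T (b′ · f)   ≈⟨ p (b′ · f) ⟩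
      T (b · (b′ · f)) ≈⟨ T-cong (sym (*-assoc b b′ f)) ⟩
      T (b · b′ · f)   ∎

    Tracks-⊟ : ∀ {a b a′ b′} → Tracks a b → Tracks a′ b′ → Tracks (a ⊟ a′) (b ⊟ b′)
    Tracks-⊟ {a} {b} {a′} {b′} p q f = begin
      (a ⊟ a′) · T f          ≈⟨ solve 3 (λ a a′ t → (a :- a′) :* t := a :* t :- a′ :* t) refl a a′ (T f) ⟩
      a · T f ⊟ a′ · T f      ≈⟨ +-cong (p f) (-‿cong (q f)) ⟩
      T (b · f) ⊟ T (b′ · f)  ≈⟨ sym (T-⊟ (b · f) (b′ · f)) ⟩
      T (b · f ⊟ b′ · f)      ≈⟨ T-cong (solve′ 3 (λ b b′ t → b ⊗ t ⊝ b′ ⊗ t ⊜ (b ⊝ b′) ⊗ t) refl b b′ f) ⟩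
      T ((b ⊟ b′) · f)        ∎
      where
      open PSSolver m using (solve; con; _:=_; _:+_; _:*_; _:-_; :-_)
      open PSSolver n using () renaming (solve to solve′; _:*_ to _⊗_; _:-_ to _⊝_; _:=_ to _⊜_)

    Tracks-geom : ∀ i → Tracks (geom (ρ i)) (geom (σ i))
    Tracks-geom i f = begin
      g′ · T f
        ≈⟨ *-congˡ (T-cong (begin
             f                                  ≈⟨ sym (*-identityˡ f) ⟩
             𝟙 · f                              ≈⟨ *-congʳ (sym (geom-inverse (σ i))) ⟩
             geom (σ i) · (𝟙 ⊟ var (σ i)) · f          ≈⟨ solve′ 3 (λ g y f → g ⊗ y ⊗ f ⊜ y ⊗ (g ⊗ f)) refl (geom (σ i)) (𝟙 ⊟ var (σ i)) f ⟩
             (𝟙 ⊟ var (σ i)) · (geom (σ i) · f)        ∎)) ⟩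
      g′ · T ((𝟙 ⊟ var (σ i)) · (geom (σ i) · f))
        ≈⟨ *-congˡ (sym (Tracks-⊟ Tracks-𝟙 (Tracks-var i) (geom (σ i) · f))) ⟩
      g′ · ((𝟙 ⊟ var (ρ i)) · T (geom (σ i) · f))
        ≈⟨ sym (*-assoc g′ _ _) ⟩
      g′ · (𝟙 ⊟ var (ρ i)) · T (geom (σ i) · f)
        ≈⟨ *-congʳ (geom-inverse (ρ i)) ⟩
      𝟙 · T (geom (σ i) · f)
        ≈⟨ *-identityˡ _ ⟩
      T (geom (σ i) · f) ∎
      where
      g′ : PS m
      g′ = geom (ρ i)
      open PSSolver n using () renaming (solve to solve′; _:*_ to _⊗_; _:=_ to _⊜_)

    Tracks-^ : ∀ {a b} k → Tracks a b → Tracks (a ^ k) (b ^ k)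
    Tracks-^ zero    p = Tracks-𝟙
    Tracks-^ (suc k) p = Tracks-· p (Tracks-^ k p)

    Tracks-Π : ∀ {k} {a : Fin k → PS m} {b : Fin k → PS n} → (∀ i → Tracks (a i) (b i)) → Tracks (Π a) (Π b)
    Tracks-Π {zero}  p = Tracks-𝟙
    Tracks-Π {suc k} p = Tracks-· (p zero) (Tracks-Π (p ∘ suc))

    Tracks-pairProduct : ∀ {k} {a : Fin k → Fin k → PS m} {b : Fin k → Fin k → PS n} →
      (∀ i j → Tracks (a i j) (b i j)) → Tracks (pairProduct a) (pairProduct b)
    Tracks-pairProduct {zero}  p = Tracks-𝟙
    Tracks-pairProduct {suc k} p = Tracks-· (Tracks-Π (p zero ∘ suc)) (Tracks-pairProduct (λ i j → p (suc i) (suc j)))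

    Tracks-vandermonde : Tracks (vandermonde (var ∘ ρ)) (vandermonde (var ∘ σ))
    Tracks-vandermonde = Tracks-pairProduct (λ i j → Tracks-⊟ (Tracks-var j) (Tracks-var i))

  removeAt-var : ∀ (r : Fin (suc n)) i f e → (var i · f) (removeAt e r) ≡ (var (punchIn r i) · (λ e → f (removeAt e r))) e
  removeAt-var zero    i       f (x ∷ e) = ≡.sym (varₛ-· i (λ e → f (removeAt e zero)) x e)
  removeAt-var (suc r) zero    f (zero ∷ y ∷ e) = ≡.trans (var₀-·-zero f _)
    (≡.sym (var₀-·-zero (λ e → f (removeAt e (suc r))) (y ∷ e)))
  removeAt-var (suc r) zero    f (suc x ∷ y ∷ e) = ≡.trans (var₀-·-suc f x _)
    (≡.sym (var₀-·-suc (λ e → f (removeAt e (suc r))) x (y ∷ e)))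
  removeAt-var (suc r) (suc i) f (x ∷ y ∷ e) = ≡.trans (varₛ-· i f x _)
    (≡.trans (removeAt-var r i (f ⟨ x ⟩) (y ∷ e))
      (≡.trans (·-cong {f = var (punchIn r i)} {g = λ e → f (x ∷ removeAt e r)} {g′ = λ e → f (removeAt (x ∷ e) (suc r))}
                  refl (λ { (_ ∷ _) → ≡.refl }) (y ∷ e))
        (≡.sym (varₛ-· (punchIn r i) (λ e → f (removeAt e (suc r))) x (y ∷ e)))))

  ⊟-at : ∀ (f g : PS n) e → (f ⊟ g) e ≡ f e ℤ.- g e
  ⊟-at f g e = ≡.trans (⊞-at f (⊟ g) e) (≡.cong (λ s → f e ℤ.+ s) (neg-at g e))

  precompose : ∀ (φ : Vec ℕ m → Vec ℕ n) {σ : Fin k → Fin n} {ρ : Fin k → Fin m} →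
    (∀ i f e → (var (σ i) · f) (φ e) ≡ (var (ρ i) · (f ∘ φ)) e) → Semilinear σ ρ
  precompose φ p = record
    { T      = _∘ φ
    ; T-cong = λ q → q ∘ φ
    ; T-⊟    = λ f g e → ≡.trans (⊟-at f g (φ e)) (≡.sym (⊟-at (f ∘ φ) (g ∘ φ) e))
    ; T-var  = p
    }

  lift : (r : Fin (suc n)) → Semilinear id (punchIn r)
  lift r = precompose (λ e → removeAt e r) (removeAt-var r)

  -- Forgetting coordinate r makes a coefficient function constant in it, which on the side of
  -- series is a factor 1/(1 - X_r).
  lift-𝟙 : ∀ (r : Fin (suc n)) e → 𝟙 (removeAt e r) ≡ geom r e
  lift-𝟙 r e = ≡.trans (constant-at 1ℤ (removeAt e r)) (at r e)
    where
    at : ∀ {n} (r : Fin (suc n)) e → const 1ℤ (removeAt e r) ≡ geom r e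
    at zero    (x ∷ e)         = ≡.sym (geom₀ x e)
    at (suc r) (zero ∷ y ∷ e)  = ≡.trans (const-zero 1ℤ (removeAt (y ∷ e) r)) (≡.trans (at r (y ∷ e)) (≡.sym (geomₛ-zero r (y ∷ e))))
    at (suc r) (suc x ∷ y ∷ e) = ≡.trans (const-suc 1ℤ x (removeAt (y ∷ e) r)) (≡.sym (geomₛ-suc r x (y ∷ e)))

  swapFin : Fin n → Fin (suc n) → Fin (suc n)
  swapFin zero    zero          = suc zero
  swapFin zero    (suc zero)    = zero
  swapFin zero    (suc (suc j)) = suc (suc j)
  swapFin (suc i) zero          = zero
  swapFin (suc i) (suc j)       = suc (swapFin i j)

  swapVec : ∀ {A : Set} → Fin n → Vec A (suc n) → Vec A (suc n)
  swapVec zero    (x ∷ y ∷ e) = y ∷ x ∷ e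
  swapVec (suc i) (x ∷ e)     = x ∷ swapVec i e

  swapVec-var : ∀ (i : Fin n) j f e → (var j · f) (swapVec i e) ≡ (var (swapFin i j) · (f ∘ swapVec i)) e
  swapVec-var zero zero f (x ∷ zero ∷ e) = ≡.trans (var₀-·-zero f _)
    (≡.sym (≡.trans (varₛ-· zero (f ∘ swapVec zero) x _) (var₀-·-zero ((f ∘ swapVec zero) ⟨ x ⟩) e)))
  swapVec-var zero zero f (x ∷ suc y ∷ e) = ≡.trans (var₀-·-suc f y _)
    (≡.sym (≡.trans (varₛ-· zero (f ∘ swapVec zero) x _) (var₀-·-suc ((f ∘ swapVec zero) ⟨ x ⟩) y e)))
  swapVec-var zero (suc zero) f (zero ∷ y ∷ e) = ≡.trans (varₛ-· zero f y _)
    (≡.trans (var₀-·-zero (f ⟨ y ⟩) e) (≡.sym (var₀-·-zero (f ∘ swapVec zero) _)))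
  swapVec-var zero (suc zero) f (suc x ∷ y ∷ e) = ≡.trans (varₛ-· zero f y _)
    (≡.trans (var₀-·-suc (f ⟨ y ⟩) x e) (≡.sym (var₀-·-suc (f ∘ swapVec zero) x _)))
  swapVec-var zero (suc (suc j)) f (x ∷ y ∷ e) =
    ≡.trans (varₛ-· (suc j) f y _) (≡.trans (varₛ-· j (f ⟨ y ⟩) x e)
      (≡.sym (≡.trans (varₛ-· (suc j) (f ∘ swapVec zero) x _) (varₛ-· j ((f ∘ swapVec zero) ⟨ x ⟩) y e))))
  swapVec-var (suc i) zero f (zero ∷ e) = ≡.trans (var₀-·-zero f _) (≡.sym (var₀-·-zero (f ∘ swapVec (suc i)) e))
  swapVec-var (suc i) zero f (suc x ∷ e) = ≡.trans (var₀-·-suc f x _) (≡.sym (var₀-·-suc (f ∘ swapVec (suc i)) x e))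
  swapVec-var (suc i) (suc j) f (x ∷ e) = ≡.trans (varₛ-· j f x _)
    (≡.trans (swapVec-var i j (f ⟨ x ⟩) e) (≡.sym (varₛ-· (swapFin i j) (f ∘ swapVec (suc i)) x e)))

  swap : (i : Fin n) → Semilinear id (swapFin i)
  swap i = precompose (swapVec i) (swapVec-var i)

  swap-𝟙 : ∀ (i : Fin n) e → 𝟙 (swapVec i e) ≡ 𝟙 e
  swap-𝟙 i e = ≡.trans (constant-at 1ℤ (swapVec i e)) (≡.trans (at i e) (≡.sym (constant-at 1ℤ e)))
    where
    at : ∀ {n} (i : Fin n) e → const 1ℤ (swapVec i e) ≡ const 1ℤ e
    at zero (zero ∷ zero ∷ e)   = ≡.refl
    at zero (zero ∷ suc y ∷ e)  = ≡.trans (const-suc 1ℤ y (0 ∷ e)) (≡.sym (≡.trans (const-zero 1ℤ (suc y ∷ e)) (const-suc 1ℤ y e)))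
    at zero (suc x ∷ zero ∷ e)  = ≡.trans (const-zero 1ℤ (suc x ∷ e)) (≡.trans (const-suc 1ℤ x e) (≡.sym (const-suc 1ℤ x (0 ∷ e))))
    at zero (suc x ∷ suc y ∷ e) = ≡.trans (const-suc 1ℤ y (suc x ∷ e)) (≡.sym (const-suc 1ℤ x (suc y ∷ e)))
    at (suc i) (zero ∷ e)       = ≡.trans (const-zero 1ℤ (swapVec i e)) (≡.trans (at i e) (≡.sym (const-zero 1ℤ e)))
    at (suc i) (suc x ∷ e)      = ≡.trans (const-suc 1ℤ x (swapVec i e)) (≡.sym (const-suc 1ℤ x e))

  Π-swap : ∀ (i : Fin k) (f : Fin (suc k) → PS n) → Π (f ∘ swapFin i) ≈ Π f
  Π-swap {n = n} zero f = solve 3 (λ a b c → b :* (a :* c) := a :* (b :* c)) refl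
    (f zero) (f (suc zero)) (Π (λ j → f (suc (suc j))))
    where open PSSolver n using (solve; con; _:=_; _:+_; _:*_; _:-_; :-_)
  Π-swap (suc i) f = *-congˡ (Π-swap i (f ∘ suc))

  vandermonde-swap : ∀ (i : Fin k) (x : Fin (suc k) → PS n) → vandermonde (x ∘ swapFin i) ≈ ⊟ vandermonde x
  vandermonde-swap {n = n} zero x =
    solve 5 (λ x y P Q V → ((x :- y) :* Q) :* (P :* V) := :- (((y :- x) :* P) :* (Q :* V))) refl
      (x zero) (x (suc zero)) (Π (λ j → x (suc (suc j)) ⊟ x zero)) (Π (λ j → x (suc (suc j)) ⊟ x (suc zero)))
      (vandermonde (λ j → x (suc (suc j))))
    where open PSSolver n using (solve; con; _:=_; _:+_; _:*_; _:-_; :-_)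
  vandermonde-swap {n = n} (suc i) x = begin
    Π (d ∘ swapFin i) · vandermonde (x ∘ suc ∘ swapFin i)
      ≈⟨ *-cong (Π-swap i d) (vandermonde-swap i (x ∘ suc)) ⟩
    Π d · (⊟ vandermonde (x ∘ suc))
      ≈⟨ solve 2 (λ a b → a :* (:- b) := :- (a :* b)) refl (Π d) (vandermonde (x ∘ suc)) ⟩
    ⊟ (Π d · vandermonde (x ∘ suc)) ∎
    where
    open PSSolver n using (solve; con; _:=_; _:+_; _:*_; _:-_; :-_)
    d = λ j → x (suc j) ⊟ x zero

  D : ∀ n → PS n
  D n = Π {n = n} (λ i → geom i ^ n) · vandermonde var

  -- Compared with `D n`, every variable carries an additional X/(1 - X): on coefficients this is
  -- summation over all smaller exponents, the inverse of Δ with value 0 at exponent 0.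
  G : ∀ n → PS n
  G n = Π {n = n} (λ i → var i · geom i ^ suc n) · vandermonde var

  G≈ : ∀ n → G n ≈ Π {n = n} (λ i → var i · geom i) · D n
  G≈ n = begin
    Π (λ i → var i · geom i ^ suc n) · V
      ≈⟨ *-congʳ {x = V} (Π-cong {n} {n} (λ i → sym (*-assoc (var i) (geom i) (geom i ^ n)))) ⟩
    Π (λ i → (var i · geom i) · geom i ^ n) · V
      ≈⟨ *-congʳ {x = V} (Π-distrib-· {n} {n} (λ i → var i · geom i) (λ i → geom i ^ n)) ⟩
    (Π (λ i → var i · geom i) · Π (λ i → geom i ^ n)) · V
      ≈⟨ *-assoc (Π (λ i → var i · geom i)) (Π (λ i → geom i ^ n)) V ⟩
    Π (λ i → var i · geom i) · (Π (λ i → geom i ^ n) · V) ∎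
    where V = vandermonde var

  Tracks-G : ∀ {ρ : Fin n → Fin m} (S : Semilinear id ρ) →
    Tracks S (Π (λ i → var (ρ i) · geom (ρ i) ^ suc n) · vandermonde (var ∘ ρ)) (G n)
  Tracks-G {n} S = Tracks-· S (Tracks-Π S (λ i → Tracks-· S (Tracks-var S i) (Tracks-^ S (suc n) (Tracks-geom S i))))
    (Tracks-vandermonde S)

  G-antisymmetric : ∀ (i : Fin n) e → G (suc n) (swapVec i e) ≡ ℤ.- G (suc n) e
  G-antisymmetric {n} i e = ≡.trans (eq e) (neg-at (G (suc n)) e)
    where
    open PSSolver (suc n) using (solve; con; _:=_; _:+_; _:*_; _:-_; :-_)
    c : Fin (suc n) → PS (suc n)
    c j = var j · geom j ^ suc (suc n)
    V = vandermonde var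
    eq : G (suc n) ∘ swapVec i ≈ ⊟ G (suc n)
    eq = begin
      G (suc n) ∘ swapVec i
        -- `Tracks` moves factors past the exchange of coordinates but needs an argument to act on,
        -- so G is read as G · 1; the exchange fixes 1.
        ≈⟨ (λ e → *-identityʳ (G (suc n)) (swapVec i e)) ⟨
      (G (suc n) · 𝟙) ∘ swapVec i
        ≈⟨ Tracks-G (swap i) 𝟙 ⟨
      Π (c ∘ swapFin i) · vandermonde (var ∘ swapFin i) · (𝟙 ∘ swapVec i)
        ≈⟨ *-cong (*-cong (Π-swap i c) (vandermonde-swap i var)) (swap-𝟙 i) ⟩
      Π c · (⊟ V) · 𝟙
        ≈⟨ solve 2 (λ a b → a :* (:- b) :* con 1ℤ := :- (a :* b)) refl (Π c) V ⟩
      ⊟ (Π c · V) ∎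

  𝟙^ : ∀ k → 𝟙 {n} ^ k ≈ 𝟙
  𝟙^ zero    = refl
  𝟙^ (suc k) = trans (*-identityˡ (𝟙 ^ k)) (𝟙^ k)

  Alt-scale : ∀ (u : PS n) (s : Fin (suc k) → PS n) → u · Alt s ≈ Alt (λ r → u · s r)
  Alt-scale {k = zero} u s = refl
  Alt-scale {n} {suc k} u s = trans
    (solve 3 (λ u a b → u :* (a :- b) := u :* a :- u :* b) refl u (s zero) (Alt (s ∘ suc)))
    (+-congˡ (-‿cong (Alt-scale u (s ∘ suc))))
    where open PSSolver n using (solve; con; _:=_; _:+_; _:*_; _:-_; :-_)

  -- This is `vandermonde-expansion` with c = x and l = 1. In term r the power (1 - X_r)^n cancels
  -- all but one of the n + 1 geometric factors of X_r, and a single one marks a function constant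
  -- in k_r. Every other variable gains the factor X_i and keeps its n + 1 geometric factors, as
  -- `G n` requires.
  D-expansion : ∀ n → D (suc n) ≈ Alt (λ r e → G n (removeAt e r))
  D-expansion n = begin
    Γ · V
      ≈⟨ *-congˡ {x = Γ} (trans (sym (*-identityˡ V)) (*-congʳ {x = V} (sym (𝟙^ n)))) ⟩
    Γ · (𝟙 ^ n · V)
      ≈⟨ *-congˡ {x = Γ} (sym (vandermonde-expansion var var 𝟙 (λ i j →
           solve 2 (λ a b → (con 1ℤ :- a) :* b :- (con 1ℤ :- b) :* a := con 1ℤ :* (b :- a)) refl (var i) (var j)))) ⟩
    Γ · Alt (λ r → (𝟙 ⊟ var r) ^ n · Π (var ∘ punchIn r) · vandermonde (var ∘ punchIn r))
      ≈⟨ Alt-scale Γ (λ r → (𝟙 ⊟ var r) ^ n · Π (var ∘ punchIn r) · vandermonde (var ∘ punchIn r)) ⟩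
    Alt (λ r → Γ · ((𝟙 ⊟ var r) ^ n · Π (var ∘ punchIn r) · vandermonde (var ∘ punchIn r)))
      ≈⟨ Alt-cong term ⟩
    Alt (λ r e → G n (removeAt e r)) ∎
    where
    open PSSolver (suc n) using (solve; con; _:=_; _:+_; _:*_; _:-_; :-_)
    Γ V : PS (suc n)
    Γ = Π (λ i → geom i ^ suc n)
    V = vandermonde var
    term : ∀ r → Γ · ((𝟙 ⊟ var r) ^ n · Π (var ∘ punchIn r) · vandermonde (var ∘ punchIn r))
      ≈ (λ e → G n (removeAt e r))
    term r = begin
      Γ · (A · X · W)
        ≈⟨ *-congʳ (Π-remove {i = r} (λ i → geom i ^ suc n)) ⟩
      (g · B · Γ′) · (A · X · W)
        ≈⟨ solve 6 (λ g B Γ A X W → (g :* B :* Γ) :* (A :* X :* W) := (B :* A) :* ((X :* Γ) :* W :* g)) refl g B Γ′ A X W ⟩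
      (B · A) · ((X · Γ′) · W · g)
        ≈⟨ *-cong (sym (^-distrib-* g (𝟙 ⊟ var r) n))
             (*-congʳ {x = g} (*-congʳ {x = W} (sym (Π-distrib-· {suc n} {n} (var ∘ punchIn r) (λ i → geom (punchIn r i) ^ suc n))))) ⟩
      (g · (𝟙 ⊟ var r)) ^ n · (Π (λ i → var (punchIn r i) · geom (punchIn r i) ^ suc n) · W · g)
        ≈⟨ *-congʳ (trans (^-congˡ n (geom-inverse r)) (𝟙^ n)) ⟩
      𝟙 · (Π (λ i → var (punchIn r i) · geom (punchIn r i) ^ suc n) · W · g)
        ≈⟨ *-identityˡ _ ⟩
      Π (λ i → var (punchIn r i) · geom (punchIn r i) ^ suc n) · W · g
        ≈⟨ *-congˡ (sym (lift-𝟙 r)) ⟩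
      Π (λ i → var (punchIn r i) · geom (punchIn r i) ^ suc n) · W · (λ e → 𝟙 (removeAt e r))
        ≈⟨ Tracks-G (lift r) 𝟙 ⟩
      (λ e → (G n · 𝟙) (removeAt e r))
        ≈⟨ (λ e → *-identityʳ (G n) (removeAt e r)) ⟩
      (λ e → G n (removeAt e r)) ∎
      where
      g A B X W Γ′ : PS (suc n)
      g = geom r
      A = (𝟙 ⊟ var r) ^ n
      B = g ^ n
      X = Π (var ∘ punchIn r)
      W = vandermonde (var ∘ punchIn r)
      Γ′ = Π (λ i → geom (punchIn r i) ^ suc n)

-- Shift operators on coefficient functions

module ShiftOperators where
  open import Data.Integer using (_+_; -_; _-_)
  open import Data.Integer.Properties
  open import Relation.Binary.PropositionalEquality
  open PowerSeriesRing using (_⟨_⟩; _≈_)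
  open ≡-Reasoning

  opaque
    -- One three-term operation serves both `V` and `U`, so that linearity and commutation become
    -- identities of `comb`. It is opaque in order that unification can read off its arguments.
    comb : ℤ → ℤ → ℤ → ℤ
    comb a b c = a + b - c

    comb-def : ∀ a b c → comb a b c ≡ a + b - c
    comb-def a b c = refl

    -- A 3 × 3 array is combined by rows or by columns. Filled with shifts of one function, it says
    -- that two operators of the form `V` or `U` commute, even when they share variables.
    comb-transpose : ∀ a₁ a₂ a₃ b₁ b₂ b₃ c₁ c₂ c₃ →
      comb (comb a₁ a₂ a₃) (comb b₁ b₂ b₃) (comb c₁ c₂ c₃) ≡ comb (comb a₁ b₁ c₁) (comb a₂ b₂ c₂) (comb a₃ b₃ c₃)
    comb-transpose = identity
      where
      identity : ∀ a₁ a₂ a₃ b₁ b₂ b₃ c₁ c₂ c₃ →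
        a₁ + a₂ - a₃ + (b₁ + b₂ - b₃) - (c₁ + c₂ - c₃) ≡ a₁ + b₁ - c₁ + (a₂ + b₂ - c₂) - (a₃ + b₃ - c₃)
      identity = solve-∀

    comb-neg : ∀ a b c → comb (- a) (- b) (- c) ≡ - comb a b c
    comb-neg = identity
      where
      identity : ∀ a b c → - a + - b - - c ≡ - (a + b - c)
      identity = solve-∀

    comb-minus : ∀ a b c a′ b′ c′ → comb (a - a′) (b - b′) (c - c′) ≡ comb a b c - comb a′ b′ c′
    comb-minus = identity
      where
      identity : ∀ a b c a′ b′ c′ → a - a′ + (b - b′) - (c - c′) ≡ a + b - c - (a′ + b′ - c′)
      identity = solve-∀

    -- Used as V = 1 on functions independent of the second variable.
    comb-cancelʳ : ∀ a b → comb a b b ≡ a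
    comb-cancelʳ = identity
      where
      identity : ∀ a b → a + b - b ≡ a
      identity = solve-∀

    -- Used as V = E, the shift of the second variable, on functions independent of the first.
    comb-cancelˡ : ∀ a b → comb a b a ≡ b
    comb-cancelˡ = identity
      where
      identity : ∀ a b → a + b - a ≡ b
      identity = solve-∀

  comb-cong : ∀ {a b c a′ b′ c′} → a ≡ a′ → b ≡ b′ → c ≡ c′ → comb a b c ≡ comb a′ b′ c′
  comb-cong refl refl refl = refl

  minus-cong : ∀ {a b a′ b′} → a ≡ a′ → b ≡ b′ → a - b ≡ a′ - b′
  minus-cong refl refl = refl

  -- The operators 1 + E_x Δ_y and 1 + E_y Δ_x, where E is the shift and Δ = E - 1.
  V U : (ℕ → ℕ → ℤ) → ℕ → ℕ → ℤ
  V q x y = comb (q x y) (q (suc x) (suc y)) (q (suc x) y)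
  U q x y = comb (q x y) (q (suc x) (suc y)) (q x (suc y))

  V-cong : ∀ {q q′ : ℕ → ℕ → ℤ} → (∀ x y → q x y ≡ q′ x y) → ∀ x y → V q x y ≡ V q′ x y
  V-cong p x y = comb-cong (p x y) (p (suc x) (suc y)) (p (suc x) y)

  -- ∏_j (1 + E_x Δ_{k_j})
  W : (ℕ → PS n) → ℕ → PS n
  W h x []      = h x []
  W h x (y ∷ k) = V (λ x y → W (λ x → h x ⟨ y ⟩) x k) x y

  -- ∏_{p<q} (1 + E_p Δ_q)
  VV : PS n → PS n
  VV f []      = f []
  VV f (x ∷ k) = W (λ x → VV (f ⟨ x ⟩)) x k

  W-cong : ∀ {h h′ : ℕ → PS n} → (∀ x → h x ≈ h′ x) → ∀ x → W h x ≈ W h′ x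
  W-cong p x []      = p x []
  W-cong p x (y ∷ k) = V-cong (λ x y → W-cong (λ x k → p x (y ∷ k)) x k) x y

  W-comb : ∀ (a b c : ℕ → PS n) x k →
    W (λ x k → comb (a x k) (b x k) (c x k)) x k ≡ comb (W a x k) (W b x k) (W c x k)
  W-comb a b c x []      = refl
  W-comb a b c x (y ∷ k) = trans
    (V-cong (λ x y → W-comb (λ x → a x ⟨ y ⟩) (λ x → b x ⟨ y ⟩) (λ x → c x ⟨ y ⟩) x k) x y)
    (comb-transpose _ _ _ _ _ _ _ _ _)

  W-neg : ∀ (a : ℕ → PS n) x k → W (λ x k → - a x k) x k ≡ - W a x k
  W-neg a x []      = refl
  W-neg a x (y ∷ k) = trans (V-cong (λ x y → W-neg (λ x → a x ⟨ y ⟩) x k) x y) (comb-neg _ _ _)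

  W-minus : ∀ (a b : ℕ → PS n) x k → W (λ x k → a x k - b x k) x k ≡ W a x k - W b x k
  W-minus a b x []      = refl
  W-minus a b x (y ∷ k) = trans
    (V-cong (λ x y → W-minus (λ x → a x ⟨ y ⟩) (λ x → b x ⟨ y ⟩) x k) x y)
    (comb-minus _ _ _ _ _ _)

  -- The factors 1 + E_x Δ_{k_j} and 1 + E_y Δ_{k_j} all commute. Hence the factors that link two
  -- leading variables to the rest of the row are jointly symmetric in those two.
  W-comm : ∀ (g : ℕ → ℕ → PS n) x y k →
    W (λ x → W (λ y → g x y) y) x k ≡ W (λ y → W (λ x → g x y) x) y k
  W-comm g x y []      = refl
  W-comm g x y (z ∷ k) = begin
    V (λ x z → W (λ x k → V (λ y z → W (λ y → g x y ⟨ z ⟩) y k) y z) x k) x z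
      ≡⟨ V-cong (λ x z → W-comb (λ x → W (λ y → g x y ⟨ z ⟩) y) (λ x → W (λ y → g x y ⟨ suc z ⟩) (suc y))
                           (λ x → W (λ y → g x y ⟨ z ⟩) (suc y)) x k) x z ⟩
    V (λ x z → V (λ y z → W (λ x → W (λ y → g x y ⟨ z ⟩) y) x k) y z) x z
      ≡⟨ V-cong (λ x z → V-cong (λ y z → W-comm (λ x y → g x y ⟨ z ⟩) x y k) y z) x z ⟩
    V (λ x z → V (λ y z → W (λ y → W (λ x → g x y ⟨ z ⟩) x) y k) y z) x z
      ≡⟨ comb-transpose _ _ _ _ _ _ _ _ _ ⟩
    V (λ y z → V (λ x z → W (λ y → W (λ x → g x y ⟨ z ⟩) x) y k) x z) y z
      ≡⟨ V-cong (λ y z → sym (W-comb (λ y → W (λ x → g x y ⟨ z ⟩) x) (λ y → W (λ x → g x y ⟨ suc z ⟩) (suc x))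
                           (λ y → W (λ x → g x y ⟨ z ⟩) (suc x)) y k)) y z ⟩
    V (λ y z → W (λ y k → V (λ x z → W (λ x → g x y ⟨ z ⟩) x k) x z) y k) y z ∎

  W-suc : ∀ (h : ℕ → PS n) x k → W (λ x → h (suc x)) x k ≡ W h (suc x) k
  W-suc h x []      = refl
  W-suc h x (y ∷ k) = V-cong {λ x y → W (λ x → h (suc x) ⟨ y ⟩) x k} {λ x y → W (λ x → h x ⟨ y ⟩) (suc x) k}
    (λ x y → W-suc (λ x → h x ⟨ y ⟩) x k) x y

  W-map : ∀ (φ : ℕ → ℕ) → (∀ y → φ (suc y) ≡ suc (φ y)) → ∀ (h : ℕ → PS n) x k →
    W (λ x k → h x (map φ k)) x k ≡ W h x (map φ k)
  W-map φ φ-suc h x []      = refl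
  W-map φ φ-suc h x (y ∷ k) = comb-cong (at x y)
    (trans (at (suc x) (suc y)) (cong (λ y → W (λ x → h x ⟨ y ⟩) (suc x) (map φ k)) (φ-suc y))) (at (suc x) y)
    where
    at : ∀ x y → W (λ x k → h x (φ y ∷ map φ k)) x k ≡ W (λ x → h x ⟨ φ y ⟩) x (map φ k)
    at x y = W-map φ φ-suc (λ x → h x ⟨ φ y ⟩) x k

  W-const : ∀ (f : PS n) x k → W (λ _ → f) x k ≡ f (map suc k)
  W-const f x []      = refl
  W-const f x (y ∷ k) = trans (V-cong (λ x y → W-const (f ⟨ y ⟩) x k) x y) (comb-cancelˡ _ _)

  VV-cong : ∀ {f g : PS n} → f ≈ g → VV f ≈ VV g
  VV-cong p []      = p []
  VV-cong p (x ∷ k) = W-cong (λ x → VV-cong (λ k → p (x ∷ k))) x k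

  VV-neg : ∀ (f : PS n) k → VV (λ k → - f k) k ≡ - VV f k
  VV-neg f []      = refl
  VV-neg f (x ∷ k) = trans (W-cong (λ x → VV-neg (f ⟨ x ⟩)) x k) (W-neg (λ x → VV (f ⟨ x ⟩)) x k)

  VV-minus : ∀ (f g : PS n) k → VV (λ k → f k - g k) k ≡ VV f k - VV g k
  VV-minus f g []      = refl
  VV-minus f g (x ∷ k) = trans (W-cong (λ x → VV-minus (f ⟨ x ⟩) (g ⟨ x ⟩)) x k)
    (W-minus (λ x → VV (f ⟨ x ⟩)) (λ x → VV (g ⟨ x ⟩)) x k)

  -- Both are alternating sums over the deleted entry. The shifted form raises the entries behind it
  -- by one, the trace left by the factors V_rq with q > r.
  alternate alternateShifted : PS n → PS (suc n)
  alternate {zero}  H (x ∷ []) = H []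
  alternate {suc n} H (x ∷ k)  = H k - alternate (H ⟨ x ⟩) k
  alternateShifted {zero}  H (x ∷ []) = H []
  alternateShifted {suc n} H (x ∷ k)  = H (map suc k) - alternateShifted (H ⟨ x ⟩) k

  alternateShifted-cong : ∀ {f g : PS n} → f ≈ g → alternateShifted f ≈ alternateShifted g
  alternateShifted-cong {zero}  p (x ∷ []) = p []
  alternateShifted-cong {suc n} p (x ∷ k)  = minus-cong (p (map suc k)) (alternateShifted-cong (λ k → p (x ∷ k)) k)

  alternateShifted-comb : ∀ (a b c : PS n) k → alternateShifted (λ k → comb (a k) (b k) (c k)) k ≡ comb (alternateShifted a k) (alternateShifted b k) (alternateShifted c k)
  alternateShifted-comb {zero}  a b c (x ∷ []) = refl
  alternateShifted-comb {suc n} a b c (x ∷ k)  = trans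
    (cong (λ s → comb (a (map suc k)) (b (map suc k)) (c (map suc k)) - s) (alternateShifted-comb (a ⟨ x ⟩) (b ⟨ x ⟩) (c ⟨ x ⟩) k))
    (sym (comb-minus (a (map suc k)) (b (map suc k)) (c (map suc k)) _ _ _))

  alternateShifted-neg : ∀ (a : PS n) k → alternateShifted (λ k → - a k) k ≡ - alternateShifted a k
  alternateShifted-neg {zero}  a (x ∷ []) = refl
  alternateShifted-neg {suc n} a (x ∷ k)  = trans
    (cong (λ s → - a (map suc k) - s) (alternateShifted-neg (a ⟨ x ⟩) k))
    (sym (neg-distrib-+ (a (map suc k)) (- alternateShifted (a ⟨ x ⟩) k)))

  -- Every term of the sum lacks one entry of the row, and the factor belonging to that entry acts
  -- on it as the identity. So the factors of the remaining entries alone act on H.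
  W-alternateShifted : ∀ (H : ℕ → PS n) x k → W (λ x → alternateShifted (H x)) x k ≡ alternateShifted (W H x) k
  W-alternateShifted {zero}  H x (y ∷ []) = comb-cancelʳ _ _
  W-alternateShifted {suc n} H x (y ∷ k)  = begin
    V (λ x y → W (λ x k → H x (map suc k) - alternateShifted (H x ⟨ y ⟩) k) x k) x y
      ≡⟨ V-cong (λ x y → trans (W-minus (λ x k → H x (map suc k)) (λ x → alternateShifted (H x ⟨ y ⟩)) x k)
           (minus-cong (W-map suc (λ _ → refl) H x k) (W-alternateShifted (λ x → H x ⟨ y ⟩) x k))) x y ⟩
    V (λ x y → W H x (map suc k) - alternateShifted (W (λ x → H x ⟨ y ⟩) x) k) x y
      ≡⟨ comb-minus _ _ _ _ _ _ ⟩
    comb (W H x (map suc k)) (W H (suc x) (map suc k)) (W H (suc x) (map suc k))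
      - V (λ x y → alternateShifted (W (λ x → H x ⟨ y ⟩) x) k) x y
      ≡⟨ minus-cong (comb-cancelʳ _ _) (sym (alternateShifted-comb _ _ _ k)) ⟩
    W H x (map suc k) - alternateShifted (λ k → V (λ x y → W (λ x → H x ⟨ y ⟩) x k) x y) k ∎

  VV-alternate : ∀ (H : PS n) → VV (alternate H) ≈ alternateShifted (VV H)
  VV-alternate {zero}  H (x ∷ []) = refl
  VV-alternate {suc n} H (x ∷ k)  = begin
    W (λ x → VV (λ k → H k - alternate (H ⟨ x ⟩) k)) x k
      ≡⟨ W-cong (λ x k → trans (VV-minus H (alternate (H ⟨ x ⟩)) k) (minus-cong {VV H k} refl (VV-alternate (H ⟨ x ⟩) k))) x k ⟩
    W (λ x k → VV H k - alternateShifted (VV (H ⟨ x ⟩)) k) x k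
      ≡⟨ W-minus (λ _ → VV H) (λ x → alternateShifted (VV (H ⟨ x ⟩))) x k ⟩
    W (λ _ → VV H) x k - W (λ x → alternateShifted (VV (H ⟨ x ⟩))) x k
      ≡⟨ minus-cong (W-const (VV H) x k) (W-alternateShifted (λ x → VV (H ⟨ x ⟩)) x k) ⟩
    VV H (map suc k) - alternateShifted (W (λ x → VV (H ⟨ x ⟩)) x) k ∎

  Δ : PS n → PS n
  Δ f []      = f []
  Δ f (x ∷ k) = Δ (f ⟨ suc x ⟩) k - Δ (f ⟨ x ⟩) k

  Δ-cong : ∀ {f g : PS n} → f ≈ g → Δ f ≈ Δ g
  Δ-cong p []      = p []
  Δ-cong p (x ∷ k) = minus-cong (Δ-cong (λ k → p (suc x ∷ k)) k) (Δ-cong (λ k → p (x ∷ k)) k)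

  Δ-comb : ∀ (a b c : PS n) k → Δ (λ k → comb (a k) (b k) (c k)) k ≡ comb (Δ a k) (Δ b k) (Δ c k)
  Δ-comb a b c []      = refl
  Δ-comb a b c (x ∷ k) = trans
    (minus-cong (Δ-comb (a ⟨ suc x ⟩) (b ⟨ suc x ⟩) (c ⟨ suc x ⟩) k) (Δ-comb (a ⟨ x ⟩) (b ⟨ x ⟩) (c ⟨ x ⟩) k))
    (sym (comb-minus _ _ _ _ _ _))

  Δ-minus : ∀ (f g : PS n) k → Δ (λ k → f k - g k) k ≡ Δ f k - Δ g k
  Δ-minus f g []      = refl
  Δ-minus f g (x ∷ k) = trans
    (minus-cong (Δ-minus (f ⟨ suc x ⟩) (g ⟨ suc x ⟩) k) (Δ-minus (f ⟨ x ⟩) (g ⟨ x ⟩) k))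
    (identity (Δ (f ⟨ suc x ⟩) k) (Δ (f ⟨ x ⟩) k) (Δ (g ⟨ suc x ⟩) k) (Δ (g ⟨ x ⟩) k))
    where
    identity : ∀ a b c d → a - c - (b - d) ≡ a - b - (c - d)
    identity = solve-∀

  Δ-W : ∀ (h : ℕ → PS n) x k → Δ (W h x) k ≡ W (λ x → Δ (h x)) x k
  Δ-W h x []      = refl
  Δ-W h x (y ∷ k) = begin
    Δ (W h x ⟨ suc y ⟩) k - Δ (W h x ⟨ y ⟩) k
      ≡⟨ minus-cong (at (suc y)) (at y) ⟩
    V w x (suc y) - V w x y
      ≡⟨ comb-minus _ _ _ _ _ _ ⟨
    V (λ x y → w x (suc y) - w x y) x y
      ≡⟨ V-cong (λ x y → W-minus (λ x → Δ (h x ⟨ suc y ⟩)) (λ x → Δ (h x ⟨ y ⟩)) x k) x y ⟨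
    V (λ x y → W (λ x k → Δ (h x ⟨ suc y ⟩) k - Δ (h x ⟨ y ⟩) k) x k) x y ∎
    where
    w : ℕ → ℕ → ℤ
    w x y = W (λ x → Δ (h x ⟨ y ⟩)) x k
    at : ∀ y → Δ (W h x ⟨ y ⟩) k ≡ V w x y
    at y = trans (Δ-comb _ _ _ k) (V-cong (λ x y → Δ-W (λ x → h x ⟨ y ⟩) x k) x y)

  -- Both sides are polynomials in the shifts with constant coefficients, and these commute.
  Δ-VV : ∀ (f : PS n) → Δ (VV f) ≈ VV (Δ f)
  Δ-VV f []      = refl
  Δ-VV f (x ∷ k) = begin
    Δ (VV f ⟨ suc x ⟩) k - Δ (VV f ⟨ x ⟩) k
      ≡⟨ minus-cong (at (suc x)) (at x) ⟩
    W w (suc x) k - W w x k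
      ≡⟨ minus-cong (W-suc w x k) refl ⟨
    W (λ x → w (suc x)) x k - W w x k
      ≡⟨ W-minus (λ x → w (suc x)) w x k ⟨
    W (λ x k → w (suc x) k - w x k) x k
      ≡⟨ W-cong (λ x → VV-minus (Δ (f ⟨ suc x ⟩)) (Δ (f ⟨ x ⟩))) x k ⟨
    VV (Δ f) (x ∷ k) ∎
    where
    w : ℕ → PS _
    w x = VV (Δ (f ⟨ x ⟩))
    at : ∀ x → Δ (VV f ⟨ x ⟩) k ≡ W w x k
    at x = trans (Δ-W (λ x → VV (f ⟨ x ⟩)) x k) (W-cong (λ x → Δ-VV (f ⟨ x ⟩)) x k)

  Antisymmetric : PS n → Set
  Antisymmetric {zero}        f = ⊤
  Antisymmetric {suc zero}    f = ⊤
  Antisymmetric {suc (suc n)} f = (∀ x y k → f (x ∷ y ∷ k) ≡ - f (y ∷ x ∷ k)) × (∀ x → Antisymmetric (f ⟨ x ⟩))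

  -- `U` is the factor with reversed indices, which `VV` does not contain. The first component
  -- treats the leading pair of coordinates, the slices `f ⟨ x ⟩` the later adjacent pairs.
  ShiftAntisymmetric : PS n → Set
  ShiftAntisymmetric {zero}        f = ⊤
  ShiftAntisymmetric {suc zero}    f = ⊤
  ShiftAntisymmetric {suc (suc n)} f =
    (∀ x y k → U (λ x y → f (x ∷ y ∷ k)) x y ≡ - U (λ x y → f (x ∷ y ∷ k)) y x) × (∀ x → ShiftAntisymmetric (f ⟨ x ⟩))

  ShiftAntisymmetric-comb : ∀ {a b c : PS n} → ShiftAntisymmetric a → ShiftAntisymmetric b → ShiftAntisymmetric c →
    ShiftAntisymmetric (λ k → comb (a k) (b k) (c k))
  ShiftAntisymmetric-comb {zero}        p q r = tt
  ShiftAntisymmetric-comb {suc zero}    p q r = tt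
  ShiftAntisymmetric-comb {suc (suc n)} (p , p′) (q , q′) (r , r′) =
    (λ x y k → trans (comb-transpose _ _ _ _ _ _ _ _ _) (trans (comb-cong (p x y k) (q x y k) (r x y k))
      (trans (comb-neg _ _ _) (cong -_ (comb-transpose _ _ _ _ _ _ _ _ _))))) ,
    (λ x → ShiftAntisymmetric-comb (p′ x) (q′ x) (r′ x))

  -- The new factors that meet a pair y, z are V_xy and V_xz. Their product is symmetric in y and z
  -- and commutes with `U`, so it preserves the antisymmetry. A slice of `W h x` is a `comb` of
  -- three expressions of the form `W`, which is why closure under `comb` is needed.
  W-shiftAntisymmetric : ∀ {h : ℕ → PS n} → (∀ x → ShiftAntisymmetric (h x)) → ∀ x → ShiftAntisymmetric (W h x)
  W-shiftAntisymmetric {zero}        p x = tt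
  W-shiftAntisymmetric {suc zero}    p x = tt
  W-shiftAntisymmetric {suc (suc n)} {h} p x =
    head ,
    (λ y → ShiftAntisymmetric-comb
      (W-shiftAntisymmetric (λ x → proj₂ (p x) y) x)
      (W-shiftAntisymmetric (λ x → proj₂ (p x) (suc y)) (suc x))
      (W-shiftAntisymmetric (λ x → proj₂ (p x) y) (suc x)))
    where
    module _ (k : Vec ℕ n) where
      Q S : ℕ → ℕ → ℕ → ℤ
      Q x y z = W (λ x k → h x (y ∷ z ∷ k)) x k
      S x y z = U (Q x) y z
      S-anti : ∀ x y z → S x z y ≡ - S x y z
      S-anti x y z = begin
        S x z y
          ≡⟨ W-comb _ _ _ x k ⟨
        W (λ x k → U (λ y z → h x (y ∷ z ∷ k)) z y) x k
          ≡⟨ W-cong (λ x k → proj₁ (p x) z y k) x k ⟩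
        W (λ x k → - U (λ y z → h x (y ∷ z ∷ k)) y z) x k
          ≡⟨ W-neg (λ x k → U (λ y z → h x (y ∷ z ∷ k)) y z) x k ⟩
        - W (λ x k → U (λ y z → h x (y ∷ z ∷ k)) y z) x k
          ≡⟨ cong -_ (W-comb _ _ _ x k) ⟩
        - S x y z ∎
      U-VV : ∀ x y z → U (λ y z → V (λ x y → V (λ x z → Q x y z) x z) x y) y z
                     ≡ V (λ x y → V (λ x z → S x y z) x z) x y
      U-VV x y z = trans (comb-transpose _ _ _ _ _ _ _ _ _)
        (comb-cong (comb-transpose _ _ _ _ _ _ _ _ _) (comb-transpose _ _ _ _ _ _ _ _ _) (comb-transpose _ _ _ _ _ _ _ _ _))
    head : ∀ y z k → U (λ y z → W h x (y ∷ z ∷ k)) y z ≡ - U (λ y z → W h x (y ∷ z ∷ k)) z y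
    head y z k = begin
      U (λ y z → W h x (y ∷ z ∷ k)) y z
        ≡⟨ U-VV k x y z ⟩
      V (λ x y → V (λ x z → S k x y z) x z) x y
        ≡⟨ V-cong (λ x y → trans (V-cong (λ x z → S-anti k x z y) x z) (comb-neg _ _ _)) x y ⟩
      V (λ x y → - V (λ x z → S k x z y) x z) x y
        ≡⟨ comb-neg _ _ _ ⟩
      - V (λ x y → V (λ x z → S k x z y) x z) x y
        ≡⟨ cong -_ (comb-transpose _ _ _ _ _ _ _ _ _) ⟩
      - V (λ x z → V (λ x y → S k x z y) x y) x z
        ≡⟨ cong -_ (U-VV k x z y) ⟨
      - U (λ y z → W h x (y ∷ z ∷ k)) z y ∎

  -- `WWf` is `VV f` without the factor V_xy of the leading pair. The factors it retains are
  -- symmetric in x and y, so it inherits the antisymmetry of f. Exchanging x and y turns V into U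
  -- and U into V, so the product U V is symmetric and U V applied to `WWf` is antisymmetric.
  VV-shiftAntisymmetric : ∀ {f : PS n} → Antisymmetric f → ShiftAntisymmetric (VV f)
  VV-shiftAntisymmetric {zero}        p = tt
  VV-shiftAntisymmetric {suc zero}    p = tt
  VV-shiftAntisymmetric {suc (suc n)} {f} (p , p′) =
    head , W-shiftAntisymmetric (λ x → VV-shiftAntisymmetric (p′ x))
    where
    module _ (k : Vec ℕ n) where
      WWf : ℕ → ℕ → ℤ
      WWf x y = W (λ x → W (λ y → VV (f ⟨ x ⟩ ⟨ y ⟩)) y) x k
      WWf-anti : ∀ x y → WWf y x ≡ - WWf x y
      WWf-anti x y = begin
        WWf y x
          ≡⟨ W-comm (λ y x → VV (f ⟨ y ⟩ ⟨ x ⟩)) y x k ⟩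
        W (λ x → W (λ y → VV (f ⟨ y ⟩ ⟨ x ⟩)) y) x k
          ≡⟨ W-cong (λ x k → trans (W-cong (λ y k → trans (VV-cong (p y x) k) (VV-neg (f ⟨ x ⟩ ⟨ y ⟩) k)) y k)
                                 (W-neg (λ y → VV (f ⟨ x ⟩ ⟨ y ⟩)) y k)) x k ⟩
        W (λ x k → - W (λ y → VV (f ⟨ x ⟩ ⟨ y ⟩)) y k) x k
          ≡⟨ W-neg (λ x → W (λ y → VV (f ⟨ x ⟩ ⟨ y ⟩)) y) x k ⟩
        - WWf x y ∎
      V-swap : ∀ x y → V WWf y x ≡ - U WWf x y
      V-swap x y = trans (comb-cong (WWf-anti x y) (WWf-anti (suc x) (suc y)) (WWf-anti x (suc y))) (comb-neg _ _ _)
    head : ∀ x y k → U (λ x y → VV f (x ∷ y ∷ k)) x y ≡ - U (λ x y → VV f (x ∷ y ∷ k)) y x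
    head x y k = begin
      U (V (WWf k)) x y
        ≡⟨ comb-transpose _ _ _ _ _ _ _ _ _ ⟩
      V (U (WWf k)) x y
        ≡⟨ neg-involutive _ ⟨
      - - V (U (WWf k)) x y
        ≡⟨ cong -_ (comb-neg _ _ _) ⟨
      - comb (- U (WWf k) x y) (- U (WWf k) (suc x) (suc y)) (- U (WWf k) (suc x) y)
        ≡⟨ cong -_ (comb-cong (V-swap k x y) (V-swap k (suc x) (suc y)) (V-swap k (suc x) y)) ⟨
      - U (V (WWf k)) y x ∎

-- The coefficient as a product of shift operators applied to `D`

module Coefficients where
  open import Data.Bool using (true; false)
  import Data.List.Relation.Unary.All.Properties as All
  open import Relation.Binary.PropositionalEquality as ≡ using (_≡_)
  open import Relation.Nullary using (does)
  open import Relation.Unary using (Pred; Decidable)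
  open PowerSeriesRing
  open Vandermonde
  open Substitutions
  open ShiftOperators
  open PSR

  ⊛≈· : ∀ (f g : PS n) → f ⊛ g ≈ f · g
  ⊛≈· f g e = ≡.cong (λ h → h e) (≡.sym (·≡⊛ f g))

  const≈𝟙 : const 1ℤ ≈ 𝟙 {n}
  const≈𝟙 e = ≡.sym (constant-at 1ℤ e)

  prodPS-tabulate : ∀ (f : Fin k → PS n) → prodPS (tabulate f) ≈ Π f
  prodPS-tabulate {zero}  f = const≈𝟙
  prodPS-tabulate {suc k} f = trans (⊛≈· (f zero) (prodPS (tabulate (f ∘ suc)))) (*-congˡ (prodPS-tabulate (f ∘ suc)))

  prodPS-++ : ∀ (fs gs : List (PS n)) → prodPS (fs ++ gs) ≈ prodPS fs · prodPS gs
  prodPS-++ []       gs = trans (sym (*-identityˡ (prodPS gs))) (*-congʳ (sym const≈𝟙))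
  prodPS-++ (f ∷ fs) gs = begin
    f ⊛ prodPS (fs ++ gs)          ≈⟨ ⊛≈· f (prodPS (fs ++ gs)) ⟩
    f · prodPS (fs ++ gs)          ≈⟨ *-congˡ (prodPS-++ fs gs) ⟩
    f · (prodPS fs · prodPS gs)    ≈⟨ *-assoc f (prodPS fs) (prodPS gs) ⟨
    f · prodPS fs · prodPS gs      ≈⟨ *-congʳ (⊛≈· f (prodPS fs)) ⟨
    (f ⊛ prodPS fs) · prodPS gs    ∎

  powPS≈^ : ∀ (f : PS n) k → powPS f k ≈ f ^ k
  powPS≈^ f zero    = const≈𝟙
  powPS≈^ f (suc k) = trans (⊛≈· f (powPS f k)) (*-congˡ (powPS≈^ f k))

  filter-map : ∀ {A B : Set} {P : Pred B 0ℓ} {Q : Pred A 0ℓ} (P? : Decidable P) (Q? : Decidable Q) (f : A → B) →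
    (∀ x → does (P? (f x)) ≡ does (Q? x)) → ∀ xs → filter P? (List.map f xs) ≡ List.map f (filter Q? xs)
  filter-map P? Q? f eq []       = ≡.refl
  filter-map P? Q? f eq (x ∷ xs) with does (P? (f x)) | does (Q? x) | eq x
  ... | true  | true  | ≡.refl = ≡.cong (f x ∷_) (filter-map P? Q? f eq xs)
  ... | false | false | ≡.refl = filter-map P? Q? f eq xs

  private
    lt? : Decidable (λ (p : Fin n × Fin n) → toℕ (proj₁ p) ℕ.< toℕ (proj₂ p))
    lt? p = toℕ (proj₁ p) ℕ.<? toℕ (proj₂ p)

    suc² : Fin n × Fin n → Fin (suc n) × Fin (suc n)
    suc² p = suc (proj₁ p) , suc (proj₂ p)

    filter-suc : ∀ (xs ys : List (Fin n)) →
      filter lt? (cartesianProduct (List.map suc xs) (zero ∷ List.map suc ys))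
        ≡ List.map suc² (filter lt? (cartesianProduct xs ys))
    filter-suc []       ys = ≡.refl
    filter-suc (x ∷ xs) ys = begin′
      filter lt? (List.map (suc x ,_) (List.map suc ys) ++ cartesianProduct (List.map suc xs) (zero ∷ List.map suc ys))
        ≡⟨ List.filter-++ lt? (List.map (suc x ,_) (List.map suc ys)) _ ⟩
      filter lt? (List.map (suc x ,_) (List.map suc ys)) ++ filter lt? (cartesianProduct (List.map suc xs) (zero ∷ List.map suc ys))
        ≡⟨ ≡.cong₂ _++_ row (filter-suc xs ys) ⟩
      List.map suc² (filter lt? (List.map (x ,_) ys)) ++ List.map suc² (filter lt? (cartesianProduct xs ys))
        ≡⟨ List.map-++ suc² (filter lt? (List.map (x ,_) ys)) _ ⟨
      List.map suc² (filter lt? (List.map (x ,_) ys) ++ filter lt? (cartesianProduct xs ys))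
        ≡⟨ ≡.cong (List.map suc²) (List.filter-++ lt? (List.map (x ,_) ys) _) ⟨
      List.map suc² (filter lt? (cartesianProduct (x ∷ xs) ys)) ∎′
      where
      open ≡.≡-Reasoning renaming (begin_ to begin′_; _∎ to _∎′)
      row : filter lt? (List.map (suc x ,_) (List.map suc ys)) ≡ List.map suc² (filter lt? (List.map (x ,_) ys))
      row = ≡.trans (≡.cong (filter lt?) (≡.trans (≡.sym (List.map-∘ ys)) (List.map-∘ ys)))
                    (filter-map lt? lt? suc² (λ _ → ≡.refl) (List.map (x ,_) ys))

  pairsLt-suc : ∀ n → pairsLt (suc n) ≡ List.map (λ j → zero , suc j) (allFin n) ++ List.map suc² (pairsLt n)
  pairsLt-suc n = begin′
    filter lt? (List.map (zero ,_) (tabulate suc) ++ cartesianProduct (tabulate suc) (zero ∷ tabulate suc))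
      ≡⟨ List.filter-++ lt? (List.map (zero ,_) (tabulate suc)) _ ⟩
    filter lt? (List.map (zero ,_) (tabulate suc)) ++ filter lt? (cartesianProduct (tabulate suc) (zero ∷ tabulate suc))
      ≡⟨ ≡.cong₂ _++_
           (≡.trans (List.filter-all lt? (All.map⁺ (All.tabulate⁺ (λ i → ℕ.s≤s ℕ.z≤n))))
             (≡.trans (List.map-tabulate suc (zero ,_)) (≡.sym (List.map-tabulate id (λ j → zero , suc j)))))
           (≡.cong (λ xs → filter lt? (cartesianProduct xs (zero ∷ xs))) (≡.sym (List.map-tabulate id suc))) ⟩
    List.map (λ j → zero , suc j) (allFin n)
      ++ filter lt? (cartesianProduct (List.map suc (allFin n)) (zero ∷ List.map suc (allFin n)))
      ≡⟨ ≡.cong (List.map (λ j → zero , suc j) (allFin n) ++_) (filter-suc (allFin n) (allFin n)) ⟩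
    List.map (λ j → zero , suc j) (allFin n) ++ List.map suc² (pairsLt n) ∎′
    where
    open ≡.≡-Reasoning renaming (begin_ to begin′_; _∎ to _∎′)

  prodPS-pairsLt : ∀ k (φ : Fin k × Fin k → PS n) →
    prodPS (List.map φ (pairsLt k)) ≈ pairProduct (λ i j → φ (i , j))
  prodPS-pairsLt zero    φ = const≈𝟙
  prodPS-pairsLt (suc k) φ = begin
    prodPS (List.map φ (pairsLt (suc k)))
      ≈⟨ (λ e → ≡.cong (λ fs → prodPS fs e) (≡.trans (≡.cong (List.map φ) (pairsLt-suc k))
           (≡.trans (List.map-++ φ (List.map (λ j → zero , suc j) (allFin k)) _)
             (≡.cong₂ _++_ (≡.trans (≡.sym (List.map-∘ (allFin k))) (List.map-tabulate id _)) (≡.sym (List.map-∘ (pairsLt k))))))) ⟩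
    prodPS (tabulate (λ j → φ (zero , suc j)) ++ List.map (φ ∘ suc²) (pairsLt k))
      ≈⟨ prodPS-++ (tabulate (λ j → φ (zero , suc j))) _ ⟩
    prodPS (tabulate (λ j → φ (zero , suc j))) · prodPS (List.map (φ ∘ suc²) (pairsLt k))
      ≈⟨ *-cong (prodPS-tabulate (λ j → φ (zero , suc j))) (prodPS-pairsLt k (φ ∘ suc²)) ⟩
    Π (λ j → φ (zero , suc j)) · pairProduct (λ i j → φ (suc i , suc j)) ∎

  pairProduct-cong : {φ ψ : Fin k → Fin k → PS n} → (∀ i j → φ i j ≈ ψ i j) → pairProduct φ ≈ pairProduct ψ
  pairProduct-cong {zero}  p = refl
  pairProduct-cong {suc k} p = *-cong (Π-cong (λ j → p zero (suc j))) (pairProduct-cong (λ i j → p (suc i) (suc j)))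

  pairProduct-distrib-· : ∀ (φ ψ : Fin k → Fin k → PS n) →
    pairProduct (λ i j → φ i j · ψ i j) ≈ pairProduct φ · pairProduct ψ
  pairProduct-distrib-· {zero}      φ ψ = sym (*-identityˡ 𝟙)
  pairProduct-distrib-· {suc k} {n} φ ψ = begin
    Π (λ j → φ zero (suc j) · ψ zero (suc j)) · pairProduct (λ i j → φ (suc i) (suc j) · ψ (suc i) (suc j))
      ≈⟨ *-cong (Π-distrib-· {n} {k} (φ zero ∘ suc) (ψ zero ∘ suc)) (pairProduct-distrib-· (λ i j → φ (suc i) (suc j)) (λ i j → ψ (suc i) (suc j))) ⟩
    Π (φ zero ∘ suc) · Π (ψ zero ∘ suc) · (pairProduct (λ i j → φ (suc i) (suc j)) · pairProduct (λ i j → ψ (suc i) (suc j)))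
      ≈⟨ solve 4 (λ a b c d → a :* b :* (c :* d) := a :* c :* (b :* d)) refl
           (Π (φ zero ∘ suc)) (Π (ψ zero ∘ suc)) (pairProduct (λ i j → φ (suc i) (suc j))) (pairProduct (λ i j → ψ (suc i) (suc j))) ⟩
    pairProduct φ · pairProduct ψ ∎
    where open PSSolver n using (solve; _:=_; _:*_)

  μ : Fin n → Fin n → PS n
  μ i j = 𝟙 ⊟ var j ⊞ var i · var j

  M : ∀ n → PS n
  M n = pairProduct μ

  mainPS≈ : ∀ n → mainPS n ≈ M n · D n
  mainPS≈ n = begin
    mainPS n
      ≈⟨ ⊛≈· (prodPS (List.map (λ i → powPS (geom i) n) (allFin n))) (prodPS (List.map factor (pairsLt n))) ⟩
    prodPS (List.map (λ i → powPS (geom i) n) (allFin n)) · prodPS (List.map factor (pairsLt n))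
      ≈⟨ *-cong
           (trans (λ e → ≡.cong (λ fs → prodPS fs e) (List.map-tabulate id (λ i → powPS (geom i) n)))
             (trans (prodPS-tabulate (λ i → powPS (geom i) n)) (Π-cong (λ i → powPS≈^ (geom i) n))))
           (trans (prodPS-pairsLt n factor)
             (trans (pairProduct-cong factor≈) (pairProduct-distrib-· (λ i j → var j ⊟ var i) μ))) ⟩
    Π (λ i → geom i ^ n) · (vandermonde var · M n)
      ≈⟨ solve 3 (λ a b c → a :* (b :* c) := c :* (a :* b)) refl (Π (λ i → geom i ^ n)) (vandermonde var) (M n) ⟩
    M n · D n ∎
    where
    open PSSolver n using (solve; _:=_; _:*_)
    factor : Fin n × Fin n → PS n
    factor p = (var (proj₂ p) ⊖ var (proj₁ p))
               ⊛ ((const 1ℤ ⊖ var (proj₂ p)) ⊕ (var (proj₁ p) ⊛ var (proj₂ p)))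
    factor≈ : ∀ i j → factor (i , j) ≈ (var j ⊟ var i) · μ i j
    factor≈ i j = trans (⊛≈· (var j ⊖ var i) ((const 1ℤ ⊖ var j) ⊕ (var i ⊛ var j))) (*-cong
      (λ e → ≡.sym (⊟-at (var j) (var i) e))
      (λ e → ≡.sym (≡.trans (⊞-at (𝟙 ⊟ var j) (var i · var j) e)
        (≡.cong₂ ℤ._+_ (≡.trans (⊟-at 𝟙 (var j) e) (≡.cong (ℤ._- var j e) (≡.sym (const≈𝟙 e))))
                       (≡.sym (⊛≈· (var i) (var j) e))))))

  -- Fixing the exponent of one variable is linear over series in the others, so factors without
  -- that variable act slice by slice. `insertAt-1` fixes the second variable instead, for the
  -- products in which the first is still involved.
  insertAt-0 : ∀ x → Semilinear {k = n} suc id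
  insertAt-0 x = precompose (x ∷_) (λ i f e → varₛ-· i f x e)

  insertAt-1 : ∀ y → Semilinear {k = suc n} (punchIn (suc zero)) id
  insertAt-1 {n} y = precompose (λ e → insertAt e (suc zero) y) at
    where
    at : ∀ i f e → (var (punchIn (suc zero) i) · f) (insertAt e (suc zero) y)
                 ≡ (var i · (λ e → f (insertAt e (suc zero) y))) e
    at zero f (zero ∷ e)  = ≡.trans (var₀-·-zero f (y ∷ e)) (≡.sym (var₀-·-zero (λ e → f (insertAt e (suc zero) y)) e))
    at zero f (suc x ∷ e) = ≡.trans (var₀-·-suc f x (y ∷ e)) (≡.sym (var₀-·-suc (λ e → f (insertAt e (suc zero) y)) x e))
    at (suc i) f (x ∷ e)  = ≡.trans (varₛ-· (suc i) f x (y ∷ e)) (≡.trans (varₛ-· i (f ⟨ x ⟩) y e)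
      (≡.sym (varₛ-· i (λ e → f (insertAt e (suc zero) y)) x e)))

  module _ {σ : Fin k → Fin n} {ρ : Fin k → Fin m} (S : Semilinear σ ρ) where
    open Semilinear S
    Tracks-μ : ∀ i j → Tracks S (μ (ρ i) (ρ j)) (μ (σ i) (σ j))
    Tracks-μ i j f = begin
      μ (ρ i) (ρ j) · T f
        -- `Tracks` is available for differences and products, so the sum in `μ` is rewritten as a
        -- nested difference.
        ≈⟨ *-congʳ (solve 2 (λ x y → con 1ℤ :- y :+ x :* y := con 1ℤ :- (y :- x :* y)) refl (var (ρ i)) (var (ρ j))) ⟩
      (𝟙 ⊟ (var (ρ j) ⊟ var (ρ i) · var (ρ j))) · T f
        ≈⟨ Tracks-⊟ S (Tracks-𝟙 S) (Tracks-⊟ S (Tracks-var S j) (Tracks-· S (Tracks-var S i) (Tracks-var S j))) f ⟩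
      T ((𝟙 ⊟ (var (σ j) ⊟ var (σ i) · var (σ j))) · f)
        ≈⟨ T-cong (*-congʳ (solve′ 2 (λ x y → con′ 1ℤ ⊝ (y ⊝ x ⊗ y) ⊜ con′ 1ℤ ⊝ y ⊹ x ⊗ y) refl (var (σ i)) (var (σ j)))) ⟩
      T (μ (σ i) (σ j) · f) ∎
      where
      open PSSolver m using (solve; con; _:=_; _:*_; _:-_; _:+_)
      open PSSolver n using () renaming (solve to solve′; con to con′; _:*_ to _⊗_; _:+_ to _⊹_; _:-_ to _⊝_; _:=_ to _⊜_)

  var₁-·-suc : ∀ (f : PS (suc (suc n))) x y e → (var (suc zero) · f) (x ∷ suc y ∷ e) ≡ f (x ∷ y ∷ e)
  var₁-·-suc f x y e = ≡.trans (varₛ-· zero f x (suc y ∷ e)) (var₀-·-suc (f ⟨ x ⟩) y e)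

  -- Reading the coefficient with both exponents raised by one amounts to dividing by X₀ X₁, which
  -- turns the factor 1 - X₁ + X₀ X₁ into V.
  μ₀₁-· : ∀ (f : PS (suc (suc n))) x y e →
    (μ zero (suc zero) · f) (suc x ∷ suc y ∷ e) ≡ comb (f (x ∷ y ∷ e)) (f (suc x ∷ suc y ∷ e)) (f (suc x ∷ y ∷ e))
  μ₀₁-· {n} f x y e = begin′
    (μ zero (suc zero) · f) (suc x ∷ suc y ∷ e)
      ≡⟨ solve 3 (λ x y f → (con 1ℤ :- y :+ x :* y) :* f := f :- y :* f :+ x :* (y :* f)) refl
           (var zero) (var (suc zero)) f (suc x ∷ suc y ∷ e) ⟩
    (f ⊟ var (suc zero) · f ⊞ var zero · (var (suc zero) · f)) (suc x ∷ suc y ∷ e)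
      ≡⟨ ⊞-at (f ⊟ var (suc zero) · f) (var zero · (var (suc zero) · f)) (suc x ∷ suc y ∷ e) ⟩
    (f ⊟ var (suc zero) · f) (suc x ∷ suc y ∷ e) ℤ.+ (var zero · (var (suc zero) · f)) (suc x ∷ suc y ∷ e)
      ≡⟨ ≡.cong₂ ℤ._+_
           (≡.trans (⊟-at f (var (suc zero) · f) (suc x ∷ suc y ∷ e))
             (≡.cong (λ s → f (suc x ∷ suc y ∷ e) ℤ.- s) (var₁-·-suc f (suc x) y e)))
           (≡.trans (var₀-·-suc (var (suc zero) · f) x (suc y ∷ e)) (var₁-·-suc f x y e)) ⟩
    f (suc x ∷ suc y ∷ e) ℤ.- f (suc x ∷ y ∷ e) ℤ.+ f (x ∷ y ∷ e)
      ≡⟨ identity (f (x ∷ y ∷ e)) (f (suc x ∷ suc y ∷ e)) (f (suc x ∷ y ∷ e)) ⟩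
    f (x ∷ y ∷ e) ℤ.+ f (suc x ∷ suc y ∷ e) ℤ.- f (suc x ∷ y ∷ e)
      ≡⟨ comb-def _ _ _ ⟨
    comb (f (x ∷ y ∷ e)) (f (suc x ∷ suc y ∷ e)) (f (suc x ∷ y ∷ e)) ∎′
    where
    open ≡.≡-Reasoning renaming (begin_ to begin′_; _∎ to _∎′)
    open PSSolver (suc (suc n)) using (solve; con; _:=_; _:*_; _:-_; _:+_)
    identity : ∀ a b c → b ℤ.- c ℤ.+ a ≡ a ℤ.+ b ℤ.- c
    identity = solve-∀

  -- X₀ occurs in all n factors and every later variable in exactly one, whence the shifts by n and
  -- by one.
  μ₀-coefficient : ∀ (f : PS (suc n)) x k →
    (Π (λ j → μ zero (suc j)) · f) (x ℕ.+ n ∷ map suc k) ≡ W (λ x → f ⟨ x ⟩) x k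
  μ₀-coefficient f x [] = ≡.trans (*-identityˡ f (x ℕ.+ 0 ∷ [])) (≡.cong (λ x → f (x ∷ [])) (ℕ.+-identityʳ x))
  μ₀-coefficient {suc n} f x (y ∷ k) = begin′
    (μ zero (suc zero) · Ψ · f) (x ℕ.+ suc n ∷ suc y ∷ map suc k)
      ≡⟨ ≡.cong (λ x → (μ zero (suc zero) · Ψ · f) (x ∷ suc y ∷ map suc k)) (ℕ.+-suc x n) ⟩
    (μ zero (suc zero) · Ψ · f) (suc (x ℕ.+ n) ∷ suc y ∷ map suc k)
      ≡⟨ *-assoc (μ zero (suc zero)) Ψ f (suc (x ℕ.+ n) ∷ suc y ∷ map suc k) ⟩
    (μ zero (suc zero) · (Ψ · f)) (suc (x ℕ.+ n) ∷ suc y ∷ map suc k)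
      ≡⟨ μ₀₁-· (Ψ · f) (x ℕ.+ n) y (map suc k) ⟩
    comb (at′ x y) (at′ (suc x) (suc y)) (at′ (suc x) y)
      ≡⟨ V-cong {at′} {λ x y → W (λ x → f ⟨ x ⟩ ⟨ y ⟩) x k} at x y ⟩
    W (λ x → f ⟨ x ⟩) x (y ∷ k) ∎′
    where
    open ≡.≡-Reasoning renaming (begin_ to begin′_; _∎ to _∎′)
    Ψ : PS (suc (suc n))
    Ψ = Π (λ j → μ zero (suc (suc j)))
    at′ : ℕ → ℕ → ℤ
    at′ x y = (Ψ · f) (x ℕ.+ n ∷ y ∷ map suc k)
    at : ∀ x y → at′ x y ≡ W (λ x → f ⟨ x ⟩ ⟨ y ⟩) x k
    at x y = ≡.trans
      (≡.sym (Tracks-Π (insertAt-1 y) (λ j → Tracks-μ (insertAt-1 y) zero (suc j)) f (x ℕ.+ n ∷ map suc k)))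
      (μ₀-coefficient (λ e → f (insertAt e (suc zero) y)) x k)

  M-coefficient : ∀ n (f : PS (suc n)) k → (M (suc n) · f) (map (ℕ._+ n) k) ≡ VV f k
  M-coefficient zero f (x ∷ []) = ≡.trans
    (solve 1 (λ f → con 1ℤ :* con 1ℤ :* f := f) refl f (x ℕ.+ 0 ∷ []))
    (≡.cong (λ x → f (x ∷ [])) (ℕ.+-identityʳ x))
    where open PSSolver 1 using (solve; con; _:=_; _:*_)
  M-coefficient (suc n) f (x ∷ k) = begin′
    (A · B · f) (x ℕ.+ suc n ∷ map (ℕ._+ suc n) k)
      ≡⟨ *-assoc A B f (x ℕ.+ suc n ∷ map (ℕ._+ suc n) k) ⟩
    (A · (B · f)) (x ℕ.+ suc n ∷ map (ℕ._+ suc n) k)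
      -- Of the `suc n` shifts of a later variable, one belongs to its pair with X₀ and n to its
      -- pairs within the rest.
      ≡⟨ ≡.cong (λ k → (A · (B · f)) (x ℕ.+ suc n ∷ k))
           (≡.trans (Vec.map-cong (λ y → ℕ.+-suc y n) k) (Vec.map-∘ suc (ℕ._+ n) k)) ⟩
    (A · (B · f)) (x ℕ.+ suc n ∷ map suc (map (ℕ._+ n) k))
      ≡⟨ μ₀-coefficient (B · f) x (map (ℕ._+ n) k) ⟩
    W (λ x → (B · f) ⟨ x ⟩) x (map (ℕ._+ n) k)
      ≡⟨ W-map (ℕ._+ n) (λ _ → ≡.refl) (λ x → (B · f) ⟨ x ⟩) x k ⟨
    W (λ x k → (B · f) (x ∷ map (ℕ._+ n) k)) x k
      ≡⟨ W-cong (λ x k → ≡.trans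
           (≡.sym (Tracks-pairProduct (insertAt-0 x) (Tracks-μ (insertAt-0 x)) f (map (ℕ._+ n) k)))
           (M-coefficient n (f ⟨ x ⟩) k)) x k ⟩
    VV f (x ∷ k) ∎′
    where
    open ≡.≡-Reasoning renaming (begin_ to begin′_; _∎ to _∎′)
    A B : PS (suc (suc n))
    A = Π (λ j → μ zero (suc j))
    B = pairProduct (λ i j → μ (suc i) (suc j))

  theCoeff≡ : ∀ n k → theCoeff (suc n) k ≡ VV (D (suc n)) k
  theCoeff≡ n k = ≡.trans (mainPS≈ (suc n) (map (ℕ._+ n) k)) (M-coefficient n (D (suc n)) k)

  Alt-⟨⟩ : ∀ (t : Fin (suc k) → PS (suc n)) x e → Alt t (x ∷ e) ≡ Alt (λ r → t r ⟨ x ⟩) e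
  Alt-⟨⟩ {zero}  t x e = ≡.refl
  Alt-⟨⟩ {suc k} t x e = ≡.trans (⊟-at (t zero) (Alt (t ∘ suc)) (x ∷ e))
    (≡.trans (≡.cong (λ s → t zero (x ∷ e) ℤ.- s) (Alt-⟨⟩ (t ∘ suc) x e))
      (≡.sym (⊟-at (t zero ⟨ x ⟩) (Alt (λ r → t (suc r) ⟨ x ⟩)) e)))

  Alt-removeAt : ∀ (H : PS n) e → Alt (λ r e → H (removeAt e r)) e ≡ alternate H e
  Alt-removeAt {zero}  H (x ∷ []) = ≡.refl
  Alt-removeAt {suc n} H (x ∷ e)  = ≡.trans (⊟-at (λ e → H (removeAt e zero)) (Alt (λ r e → H (removeAt e (suc r)))) (x ∷ e))
    (≡.cong (λ s → H e ℤ.- s) (≡.trans (Alt-⟨⟩ (λ r e → H (removeAt e (suc r))) x e)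
      (≡.trans (Alt-cong {s = λ r e → H (removeAt (x ∷ e) (suc r))} {t = λ r e → H (x ∷ removeAt e r)} (λ { r (_ ∷ _) → ≡.refl }) e)
        (Alt-removeAt (H ⟨ x ⟩) e))))

  D≈alternate-G : ∀ n → D (suc n) ≈ alternate (G n)
  D≈alternate-G n e = ≡.trans (D-expansion n e) (Alt-removeAt (G n) e)

  -- For one variable, P = X/(1 - X) · h satisfies P = X · (h + P), hence P(x + 1) - P(x) = h(x).
  -- This is `difference`; the other variables follow by induction on the slices.
  Δ-Π : ∀ (f : PS n) → Δ (Π (λ i → var i · geom i) · f) ≈ f
  Δ-Π f [] = *-identityˡ f []
  Δ-Π {suc n} f (x ∷ k) = begin′
    Δ (P ⟨ suc x ⟩) k ℤ.- Δ (P ⟨ x ⟩) k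
      ≡⟨ Δ-minus (P ⟨ suc x ⟩) (P ⟨ x ⟩) k ⟨
    Δ (λ k → P (suc x ∷ k) ℤ.- P (x ∷ k)) k
      ≡⟨ Δ-cong (λ k → ≡.trans (difference k)
           (≡.sym (Tracks-Π (insertAt-0 x) (λ i → Tracks-· (insertAt-0 x) (Tracks-var (insertAt-0 x) i) (Tracks-geom (insertAt-0 x) i)) f k))) k ⟩
    Δ (Π (λ i → var i · geom i) · f ⟨ x ⟩) k
      ≡⟨ Δ-Π (f ⟨ x ⟩) k ⟩
    f (x ∷ k) ∎′
    where
    open ≡.≡-Reasoning renaming (begin_ to begin′_; _∎ to _∎′)
    open PSSolver (suc n) using (solve; con; _:=_; _:*_; _:-_; _:+_)
    P Q h u : PS (suc n)
    Q = Π (λ i → var (suc i) · geom (suc i))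
    P = var zero · geom zero · Q · f
    h = Q · f
    u = geom zero · h
    P≈ : P ≈ var zero · u
    P≈ = solve 4 (λ x g q f → x :* g :* q :* f := x :* (g :* (q :* f))) refl (var zero) (geom zero) Q f
    u≈ : u ≈ h ⊞ P
    u≈ = trans (*-congʳ {x = h} (geom-unfold zero))
      (trans (solve 3 (λ x g h → (con 1ℤ :+ x :* g) :* h := h :+ x :* (g :* h)) refl (var zero) (geom zero) h)
        (+-congˡ (sym P≈)))
    difference : ∀ k → P (suc x ∷ k) ℤ.- P (x ∷ k) ≡ h (x ∷ k)
    difference k = begin′
      P (suc x ∷ k) ℤ.- P (x ∷ k)
        ≡⟨ ≡.cong (ℤ._- P (x ∷ k)) (≡.trans (P≈ (suc x ∷ k)) (≡.trans (var₀-·-suc u x k)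
             (≡.trans (u≈ (x ∷ k)) (⊞-at h P (x ∷ k))))) ⟩
      h (x ∷ k) ℤ.+ P (x ∷ k) ℤ.- P (x ∷ k)
        ≡⟨ identity (h (x ∷ k)) (P (x ∷ k)) ⟩
      h (x ∷ k) ∎′
      where
      identity : ∀ a b → a ℤ.+ b ℤ.- b ≡ a
      identity = solve-∀

  Δ-G : ∀ n → Δ (G n) ≈ D n
  Δ-G n k = ≡.trans (Δ-cong (G≈ n) k) (Δ-Π (D n) k)

  antisymmetric-from-swaps : ∀ {f : PS (suc n)} → (∀ i k → f (swapVec i k) ≡ ℤ.- f k) → Antisymmetric f
  antisymmetric-from-swaps {zero}  p = tt
  antisymmetric-from-swaps {suc n} p = (λ x y k → p zero (y ∷ x ∷ k)) , λ x → antisymmetric-from-swaps (λ i k → p (suc i) (x ∷ k))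

  VV-G-shiftAntisymmetric : ∀ n → ShiftAntisymmetric (VV (G n))
  VV-G-shiftAntisymmetric zero    = tt
  VV-G-shiftAntisymmetric (suc n) = VV-shiftAntisymmetric (antisymmetric-from-swaps G-antisymmetric)

  VV-D-expansion : ∀ n → VV (D (suc n)) ≈ alternateShifted (VV (G n))
  VV-D-expansion n k = ≡.trans (VV-cong (D≈alternate-G n) k) (VV-alternate (G n) k)

  Δ-VV-G : ∀ n → Δ (VV (G n)) ≈ VV (D n)
  Δ-VV-G n k = ≡.trans (Δ-VV (G n) k) (VV-cong (Δ-G n) k)

-- Telescoping over interlacing rows

module Triangles where
  open import Data.Integer using (_+_; _*_; -_; _-_)
  open import Data.Integer.Properties
  open import Data.List.Membership.Propositional using (_∈_; lose; find)
  open import Data.List.Membership.Propositional.Properties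
    using (∈-map⁺; ∈-map⁻; ∈-concatMap⁺; ∈-concatMap⁻; ∈-applyUpTo⁺; ∈-applyUpTo⁻)
  open import Data.List.Relation.Unary.All as All using (All; []; _∷_)
  import Data.List.Relation.Unary.All.Properties as All
  open import Data.List.Relation.Unary.AllPairs as AllPairs using ([]; _∷_)
  import Data.List.Relation.Unary.AllPairs.Properties as AllPairs
  open import Data.List.Relation.Unary.Any using (here)
  open import Data.List.Relation.Unary.Unique.Propositional using (Unique)
  import Data.List.Relation.Unary.Unique.Propositional.Properties as Unique
  open import Data.Vec using (head)
  open import Relation.Binary.PropositionalEquality
  open PowerSeriesRing
  open Substitutions
  open ShiftOperators
  open Coefficients
  open ≡-Reasoning

  private variable
    A B : Set

  sumOver : List A → (A → ℤ) → ℤ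
  sumOver xs f = sumℤ (List.map f xs)

  sumOver-cong : ∀ {f g : A → ℤ} {xs} → All (λ x → f x ≡ g x) xs → sumOver xs f ≡ sumOver xs g
  sumOver-cong []       = refl
  sumOver-cong (p ∷ ps) = cong₂ _+_ p (sumOver-cong ps)

  sumOver-minus : ∀ (f g : A → ℤ) xs → sumOver xs (λ x → f x - g x) ≡ sumOver xs f - sumOver xs g
  sumOver-minus f g []       = refl
  sumOver-minus f g (x ∷ xs) = trans (cong (λ s → f x - g x + s) (sumOver-minus f g xs))
    (identity (f x) (g x) (sumOver xs f) (sumOver xs g))
    where
    identity : ∀ a b c d → a - b + (c - d) ≡ a + c - (b + d)
    identity = solve-∀

  telescope : ∀ (g a : ℕ → ℤ) d → (∀ i → i ℕ.< d → g i ≡ a (suc i) - a i) → sumℤ (applyUpTo g d) ≡ a d - a 0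
  telescope g a zero    p = sym (+-inverseʳ (a 0))
  telescope g a (suc d) p = trans
    (cong₂ _+_ (p 0 (s≤s z≤n)) (telescope (g ∘ suc) (a ∘ suc) d (λ i i<d → p (suc i) (s≤s i<d))))
    (identity (a 0) (a 1) (a (suc d)))
    where
    identity : ∀ a b c → b - a + (c - b) ≡ c - a
    identity = solve-∀

  -- For y < lo the truncated subtraction leaves the single element lo rather than nothing, so
  -- membership yields both bounds only under lo ≤ y.
  interval : ℕ → ℕ → List ℕ
  interval lo y = applyUpTo (lo ℕ.+_) (suc (y ∸ lo))

  -- The strictly increasing rows l with lo ≤ l₁ ≤ k₁ ≤ l₂ ≤ k₂ ≤ ….
  rows : ℕ → Vec ℕ n → List (Vec ℕ n)
  rows lo []      = [] ∷ []
  rows lo (y ∷ k) = concatMap (λ l → List.map (l ∷_) (rows (y ⊔ suc l) k)) (interval lo y)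

  -- The bound `y ⊔ suc l` for the next entry joins interlacing (at least y) with strictness (above
  -- l). Since l ≤ y, it exceeds y only for l = y, where it is `suc y`.
  Between : ℕ → Vec ℕ n → Vec ℕ n → Set
  Between lo []      []       = ⊤
  Between lo (y ∷ k) (l ∷ ls) = lo ℕ.≤ l × l ℕ.≤ y × Between (y ⊔ suc l) k ls

  IncreasingFrom : ℕ → Vec ℕ n → Set
  IncreasingFrom lo []      = ⊤
  IncreasingFrom lo (y ∷ k) = lo ℕ.≤ y × IncreasingFrom (suc y) k

  IncreasingFrom-weaken : ∀ {lo lo′} {k : Vec ℕ n} → lo ℕ.≤ lo′ → IncreasingFrom lo′ k → IncreasingFrom lo k
  IncreasingFrom-weaken {k = []}    p _       = tt
  IncreasingFrom-weaken {k = y ∷ k} p (q , r) = ℕ.≤-trans p q , r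

  bound≤suc : ∀ {l y} → l ℕ.≤ y → y ⊔ suc l ℕ.≤ suc y
  bound≤suc {y = y} l≤y = ℕ.⊔-lub (ℕ.n≤1+n y) (s≤s l≤y)

  interval-∈⁻ : ∀ {lo y l} → lo ℕ.≤ y → l ∈ interval lo y → lo ℕ.≤ l × l ℕ.≤ y
  interval-∈⁻ {lo} {y} lo≤y p with ∈-applyUpTo⁻ (lo ℕ.+_) p
  ... | i , s≤s i≤d , refl = ℕ.m≤m+n lo i , subst (lo ℕ.+ i ℕ.≤_) (ℕ.m+[n∸m]≡n lo≤y) (ℕ.+-monoʳ-≤ lo i≤d)

  interval-∈⁺ : ∀ {lo y l} → lo ℕ.≤ l → l ℕ.≤ y → l ∈ interval lo y
  interval-∈⁺ {lo} {y} {l} lo≤l l≤y = subst (_∈ interval lo y) (ℕ.m+[n∸m]≡n lo≤l)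
    (∈-applyUpTo⁺ (lo ℕ.+_) (s≤s (ℕ.∸-monoˡ-≤ lo l≤y)))

  rows-∈⁻ : ∀ {lo} (k l : Vec ℕ n) → IncreasingFrom lo k → l ∈ rows lo k → Between lo k l
  rows-∈⁻ []      []       _            _ = tt
  rows-∈⁻ (y ∷ k) (l ∷ ls) (lo≤y , inc) p
    with find (∈-concatMap⁻ (λ l → List.map (l ∷_) (rows (y ⊔ suc l) k)) p)
  ... | l , l∈ , q with ∈-map⁻ (l ∷_) q
  ... | _ , ls∈ , refl =
    let lo≤l , l≤y = interval-∈⁻ lo≤y l∈
    in lo≤l , l≤y , rows-∈⁻ k ls (IncreasingFrom-weaken (bound≤suc l≤y) inc) ls∈

  rows-∈⁺ : ∀ {lo} (k l : Vec ℕ n) → Between lo k l → l ∈ rows lo k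
  rows-∈⁺ []      []       _                 = here refl
  rows-∈⁺ (y ∷ k) (l ∷ ls) (lo≤l , l≤y , b) =
    ∈-concatMap⁺ (λ l → List.map (l ∷_) (rows (y ⊔ suc l) k))
      (lose (interval-∈⁺ lo≤l l≤y) (∈-map⁺ (l ∷_) (rows-∈⁺ k ls b)))

  Between⇒IncreasingFrom : ∀ {lo} (k l : Vec ℕ n) → Between lo k l → IncreasingFrom lo l
  Between⇒IncreasingFrom []      []       _              = tt
  Between⇒IncreasingFrom (y ∷ k) (l ∷ ls) (lo≤l , _ , b) =
    lo≤l , IncreasingFrom-weaken (ℕ.m≤n⊔m y (suc l)) (Between⇒IncreasingFrom k ls b)

  Unique-concatMap : ∀ {f : A → List B} {xs} → Unique xs → (∀ x → Unique (f x)) →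
    (∀ {x y z} → z ∈ f x → z ∈ f y → x ≡ y) → Unique (concatMap f xs)
  Unique-concatMap {xs = xs} u v w = Unique.concat⁺
    (All.map⁺ (All.universal v xs))
    (AllPairs.map⁺ (AllPairs.map (λ x≢y {z} p → x≢y (w (proj₁ p) (proj₂ p))) u))

  rows-unique : ∀ lo (k : Vec ℕ n) → Unique (rows lo k)
  rows-unique lo []      = [] ∷ []
  rows-unique lo (y ∷ k) = Unique-concatMap
    (Unique.applyUpTo⁺₁ (lo ℕ.+_) (suc (y ∸ lo)) (λ i<j _ eq → ℕ.<⇒≢ i<j (ℕ.+-cancelˡ-≡ lo _ _ eq)))
    (λ l → Unique.map⁺ Vec.∷-injectiveʳ (rows-unique (y ⊔ suc l) k))
    (λ p q → trans (sym (heads p)) (heads q))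
    where
    heads : ∀ {l ls} → ls ∈ List.map (l ∷_) (rows (y ⊔ suc l) k) → head ls ≡ l
    heads p with ∈-map⁻ _ p
    ... | _ , _ , refl = refl

  ≡-neg⇒≡0 : ∀ i → i ≡ - i → i ≡ 0ℤ
  ≡-neg⇒≡0 (ℤ.+ 0) p = refl

  -- Once the terms that delete the second argument of H are set aside, the rest of the three sums
  -- combines to `alternateShifted` of U H with both leading coordinates equal to y.
  -- Shift-antisymmetry makes this its own negative, hence 0.
  alternateShifted-diagonal : ∀ {H : PS (suc n)} → ShiftAntisymmetric H → ∀ y k →
    comb (alternateShifted (H ⟨ y ⟩) (y ∷ k)) (alternateShifted (H ⟨ suc y ⟩) (suc y ∷ k)) (alternateShifted (H ⟨ y ⟩) (suc y ∷ k)) ≡ H (suc y ∷ map suc k)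
  alternateShifted-diagonal {zero}  p y []      = comb-cancelˡ _ _
  alternateShifted-diagonal {suc n} {H} (p , _) y k = begin
    comb (H (y ∷ map suc k) - alternateShifted (H ⟨ y ⟩ ⟨ y ⟩) k) (H (suc y ∷ map suc k) - alternateShifted (H ⟨ suc y ⟩ ⟨ suc y ⟩) k)
         (H (y ∷ map suc k) - alternateShifted (H ⟨ y ⟩ ⟨ suc y ⟩) k)
      ≡⟨ comb-minus _ _ _ _ _ _ ⟩
    comb (H (y ∷ map suc k)) (H (suc y ∷ map suc k)) (H (y ∷ map suc k)) - d
      ≡⟨ minus-cong (comb-cancelˡ _ _) d≡0 ⟩
    H (suc y ∷ map suc k) - 0ℤ
      ≡⟨ +-identityʳ _ ⟩
    H (suc y ∷ map suc k) ∎
    where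
    D′ : PS n
    D′ k = U (λ x y → H (x ∷ y ∷ k)) y y
    d : ℤ
    d = comb (alternateShifted (H ⟨ y ⟩ ⟨ y ⟩) k) (alternateShifted (H ⟨ suc y ⟩ ⟨ suc y ⟩) k) (alternateShifted (H ⟨ y ⟩ ⟨ suc y ⟩) k)
    d≡ : alternateShifted D′ k ≡ d
    d≡ = alternateShifted-comb (H ⟨ y ⟩ ⟨ y ⟩) (H ⟨ suc y ⟩ ⟨ suc y ⟩) (H ⟨ y ⟩ ⟨ suc y ⟩) k
    d≡0 : d ≡ 0ℤ
    d≡0 = trans (sym d≡) (≡-neg⇒≡0 (alternateShifted D′ k) (trans (alternateShifted-cong (p y y) k) (alternateShifted-neg D′ k)))

  -- By induction the sum over the later entries turns Δ in the first entry into a difference `g l`,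
  -- which telescopes as long as the next bound stays y. The bound lo is a parameter of its own
  -- because the bound handed on can be `suc y`, which need not be an entry of the given row.
  sum-rows : ∀ {lo} (k : Vec ℕ n) {H : PS n} → IncreasingFrom lo k → ShiftAntisymmetric H →
    sumOver (rows lo k) (Δ H) ≡ alternateShifted H (lo ∷ k)
  sum-rows {lo = lo} []      {H} _            _ = +-identityʳ (H [])
  sum-rows {suc n} {lo} (y ∷ k) {H} (lo≤y , inc) p = begin
    sumOver (rows lo (y ∷ k)) (Δ H)
      ≡⟨ sumℤ-concatMap (Δ H) (λ l → List.map (l ∷_) (rows (y ⊔ suc l) k)) (interval lo y) ⟩
    sumOver (interval lo y) (λ l → sumOver (List.map (l ∷_) (rows (y ⊔ suc l) k)) (Δ H))
      ≡⟨ sumOver-cong (All.tabulate {xs = interval lo y} (λ l∈ → inner _ (proj₂ (interval-∈⁻ lo≤y l∈)))) ⟩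
    sumOver (interval lo y) g
      ≡⟨ cong sumℤ (List.map-applyUpTo (lo ℕ.+_) g (suc d)) ⟩
    sumℤ (applyUpTo (g ∘ (lo ℕ.+_)) (suc d))
      -- The summand with l = y is set apart: there strictness raises the next bound from y to
      -- `suc y`, and the telescoping pattern breaks.
      ≡⟨ cong sumℤ (List.applyUpTo-∷ʳ (g ∘ (lo ℕ.+_)) d) ⟨
    sumℤ (applyUpTo (g ∘ (lo ℕ.+_)) d ++ g (lo ℕ.+ d) ∷ [])
      ≡⟨ sumℤ-++ (applyUpTo (g ∘ (lo ℕ.+_)) d) _ ⟩
    sumℤ (applyUpTo (g ∘ (lo ℕ.+_)) d) + (g (lo ℕ.+ d) + 0ℤ)
      ≡⟨ cong₂ _+_ (telescope (g ∘ (lo ℕ.+_)) (a ∘ (lo ℕ.+_)) d below) (+-identityʳ (g (lo ℕ.+ d))) ⟩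
    a (lo ℕ.+ d) - a (lo ℕ.+ 0) + g (lo ℕ.+ d)
      ≡⟨ cong₂ (λ i j → a i - a j + g i) (ℕ.m+[n∸m]≡n lo≤y) (ℕ.+-identityʳ lo) ⟩
    a y - a lo + g y
      ≡⟨ cong (λ b → a y - a lo + (alternateShifted (H ⟨ suc y ⟩) (b ∷ k) - alternateShifted (H ⟨ y ⟩) (b ∷ k))) (ℕ.m≤n⇒m⊔n≡n (ℕ.n≤1+n y)) ⟩
    a y - a lo + (alternateShifted (H ⟨ suc y ⟩) (suc y ∷ k) - alternateShifted (H ⟨ y ⟩) (suc y ∷ k))
      ≡⟨ identity (a y) (a lo) (alternateShifted (H ⟨ suc y ⟩) (suc y ∷ k)) (alternateShifted (H ⟨ y ⟩) (suc y ∷ k)) ⟩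
    (a y + alternateShifted (H ⟨ suc y ⟩) (suc y ∷ k) - alternateShifted (H ⟨ y ⟩) (suc y ∷ k)) - a lo
      ≡⟨ cong (_- a lo) (comb-def (a y) _ _) ⟨
    comb (a y) (alternateShifted (H ⟨ suc y ⟩) (suc y ∷ k)) (alternateShifted (H ⟨ y ⟩) (suc y ∷ k)) - a lo
      ≡⟨ cong (_- a lo) (alternateShifted-diagonal p y k) ⟩
    H (suc y ∷ map suc k) - a lo ∎
    where
    d : ℕ
    d = y ∸ lo
    a g : ℕ → ℤ
    a l = alternateShifted (H ⟨ l ⟩) (y ∷ k)
    g l = alternateShifted (H ⟨ suc l ⟩) (y ⊔ suc l ∷ k) - alternateShifted (H ⟨ l ⟩) (y ⊔ suc l ∷ k)
    slices : ∀ {n} {H : PS (suc n)} → ShiftAntisymmetric H → ∀ l → ShiftAntisymmetric (H ⟨ l ⟩)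
    slices {zero}  p l = tt
    slices {suc n} p l = proj₂ p l
    inner : ∀ l → l ℕ.≤ y → sumOver (List.map (l ∷_) (rows (y ⊔ suc l) k)) (Δ H) ≡ g l
    inner l l≤y = begin
      sumOver (List.map (l ∷_) (rows b k)) (Δ H)
        ≡⟨ cong sumℤ (List.map-∘ (rows b k)) ⟨
      sumOver (rows b k) (λ ls → Δ (H ⟨ suc l ⟩) ls - Δ (H ⟨ l ⟩) ls)
        ≡⟨ sumOver-minus (Δ (H ⟨ suc l ⟩)) (Δ (H ⟨ l ⟩)) (rows b k) ⟩
      sumOver (rows b k) (Δ (H ⟨ suc l ⟩)) - sumOver (rows b k) (Δ (H ⟨ l ⟩))
        ≡⟨ minus-cong (sum-rows k inc′ (slices p (suc l))) (sum-rows k inc′ (slices p l)) ⟩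
      g l ∎
      where
      b : ℕ
      b = y ⊔ suc l
      inc′ : IncreasingFrom b k
      inc′ = IncreasingFrom-weaken (bound≤suc l≤y) inc
    below : ∀ i → i ℕ.< d → g (lo ℕ.+ i) ≡ a (lo ℕ.+ suc i) - a (lo ℕ.+ i)
    below i i<d = trans
      (cong (λ b → alternateShifted (H ⟨ suc (lo ℕ.+ i) ⟩) (b ∷ k) - alternateShifted (H ⟨ lo ℕ.+ i ⟩) (b ∷ k))
        (ℕ.m≥n⇒m⊔n≡m (subst (lo ℕ.+ i ℕ.<_) (ℕ.m+[n∸m]≡n lo≤y) (ℕ.+-monoʳ-< lo i<d))))
      (cong (λ j → a j - a (lo ℕ.+ i)) (sym (ℕ.+-suc lo i)))
    identity : ∀ a b c d → a - b + (c - d) ≡ a + c - d - b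
    identity = solve-∀

  -- Enumeration of the monotone triangles with a given bottom row

  triangles : ∀ n → Vec ℕ n → List (Tri n)
  triangles zero    []      = tt ∷ []
  triangles (suc n) (x ∷ k) = concatMap (λ l → List.map (_, map ℤ.+_ (x ∷ k)) (triangles n l)) (rows x k)

  rows-increasing : ∀ {x} (k : Vec ℕ n) → IncreasingFrom 0 (x ∷ k) → All (IncreasingFrom 0) (rows x k)
  rows-increasing {x = x} k (_ , inc) = All.tabulate λ {l} l∈ →
    IncreasingFrom-weaken z≤n (Between⇒IncreasingFrom k l (rows-∈⁻ k l (IncreasingFrom-weaken (ℕ.n≤1+n x) inc) l∈))

  length-concatMap : ∀ (f : A → List B) xs → ℤ.+ length (concatMap f xs) ≡ sumOver xs (λ x → ℤ.+ length (f x))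
  length-concatMap f []       = refl
  length-concatMap f (x ∷ xs) = trans (cong ℤ.+_ (List.length-++ (f x)))
    (trans (pos-+ (length (f x)) _) (cong (λ s → ℤ.+ length (f x) + s) (length-concatMap f xs)))

  VV-D-counts : ∀ n (k : Vec ℕ n) → IncreasingFrom 0 k → VV (D n) k ≡ ℤ.+ length (triangles n k)
  -- The recursion starts at the empty triangle, counted once, against the empty product 1.
  VV-D-counts zero    []      _   = trans (·-[] 𝟙 𝟙) (cong₂ _*_ (constant-at 1ℤ []) (constant-at 1ℤ []))
  VV-D-counts (suc n) (x ∷ k) inc = begin
    VV (D (suc n)) (x ∷ k)
      ≡⟨ VV-D-expansion n (x ∷ k) ⟩
    alternateShifted (VV (G n)) (x ∷ k)
      ≡⟨ sum-rows k (IncreasingFrom-weaken (ℕ.n≤1+n x) (proj₂ inc)) (VV-G-shiftAntisymmetric n) ⟨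
    sumOver (rows x k) (Δ (VV (G n)))
      ≡⟨ sumOver-cong (All.map (λ {l} inc′ → trans (Δ-VV-G n l) (trans (VV-D-counts n l inc′)
           (cong ℤ.+_ (sym (List.length-map _ (triangles n l)))))) (rows-increasing k inc)) ⟩
    sumOver (rows x k) (λ l → ℤ.+ length (List.map (_, map ℤ.+_ (x ∷ k)) (triangles n l)))
      ≡⟨ length-concatMap (λ l → List.map (_, map ℤ.+_ (x ∷ k)) (triangles n l)) (rows x k) ⟨
    ℤ.+ length (triangles (suc n) (x ∷ k)) ∎

  map-+-injective : ∀ {l l′ : Vec ℕ n} → map ℤ.+_ l ≡ map ℤ.+_ l′ → l ≡ l′
  map-+-injective {l = []}    {[]}     _ = refl
  map-+-injective {l = x ∷ l} {y ∷ l′} p = cong₂ _∷_ (+-injective (Vec.∷-injectiveˡ p)) (map-+-injective (Vec.∷-injectiveʳ p))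

  triangles-∈⁻ : ∀ {n x} {k : Vec ℕ n} {t r} → (t , r) ∈ triangles (suc n) (x ∷ k) →
    r ≡ map ℤ.+_ (x ∷ k) × ∃ λ l → l ∈ rows x k × t ∈ triangles n l
  triangles-∈⁻ {n} {x} {k} p with find (∈-concatMap⁻ (λ l → List.map (_, map ℤ.+_ (x ∷ k)) (triangles n l)) {rows x k} p)
  ... | l , l∈ , q with ∈-map⁻ (_, map ℤ.+_ (x ∷ k)) {xs = triangles n l} q
  ... | t , t∈ , refl = refl , l , l∈ , t∈

  -- A triangle contains its bottom row, from which l can be read off; so the lists joined in
  -- `triangles` do not overlap.
  triangles-disjoint : ∀ n {l l′ : Vec ℕ n} {t} → t ∈ triangles n l → t ∈ triangles n l′ → l ≡ l′
  triangles-disjoint zero    {[]}    {[]}     p q = refl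
  triangles-disjoint (suc n) {_ ∷ _} {_ ∷ _} {_ , _} p q =
    map-+-injective (trans (sym (proj₁ (triangles-∈⁻ p))) (proj₁ (triangles-∈⁻ q)))

  triangles-unique : ∀ n (k : Vec ℕ n) → Unique (triangles n k)
  triangles-unique zero    []      = [] ∷ []
  triangles-unique (suc n) (x ∷ k) = Unique-concatMap (rows-unique x k)
    (λ l → Unique.map⁺ (cong proj₁) (triangles-unique n l))
    (λ {l} {l′} p q → disjoint l l′ p q)
    where
    disjoint : ∀ l l′ {t} → t ∈ List.map (_, map ℤ.+_ (x ∷ k)) (triangles n l) →
      t ∈ List.map (_, map ℤ.+_ (x ∷ k)) (triangles n l′) → l ≡ l′
    disjoint l l′ p q with ∈-map⁻ (_, map ℤ.+_ (x ∷ k)) {xs = triangles n l} p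
                         | ∈-map⁻ (_, map ℤ.+_ (x ∷ k)) {xs = triangles n l′} q
    ... | _ , p′ , refl | _ , q′ , refl = triangles-disjoint n p′ q′

  StrictlyIncreasing : Vec ℕ (suc n) → Set
  StrictlyIncreasing {n} k = (j : Fin n) → lookup k (inject₁ j) ℕ.< lookup k (suc j)

  strict⇒IncreasingFrom : ∀ (k : Vec ℕ (suc n)) → StrictlyIncreasing k → ∀ {lo} → lo ℕ.≤ lookup k zero → IncreasingFrom lo k
  strict⇒IncreasingFrom (x ∷ [])    p lo≤x = lo≤x , tt
  strict⇒IncreasingFrom (x ∷ y ∷ k) p lo≤x = lo≤x , strict⇒IncreasingFrom (y ∷ k) (p ∘ suc) (p zero)

  IncreasingFrom⇒strict : ∀ {lo} (k : Vec ℕ (suc n)) → IncreasingFrom lo k → StrictlyIncreasing k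
  IncreasingFrom⇒strict (x ∷ y ∷ k) (_ , p) zero    = proj₁ p
  IncreasingFrom⇒strict (x ∷ y ∷ k) (_ , p) (suc j) = IncreasingFrom⇒strict (y ∷ k) p j

  Interlacing : Vec ℕ n → Vec ℕ (suc n) → Set
  Interlacing {n} l k = (j : Fin n) → lookup k (inject₁ j) ℕ.≤ lookup l j × lookup l j ℕ.≤ lookup k (suc j)

  Between⇒Interlacing : ∀ {x lo} (k l : Vec ℕ n) → x ℕ.≤ lo → Between lo k l → Interlacing l (x ∷ k)
  Between⇒Interlacing (y ∷ k) (l ∷ ls) x≤lo (lo≤l , l≤y , b) zero    = ℕ.≤-trans x≤lo lo≤l , l≤y
  Between⇒Interlacing (y ∷ k) (l ∷ ls) x≤lo (lo≤l , l≤y , b) (suc j) = Between⇒Interlacing k ls (ℕ.m≤m⊔n y (suc l)) b j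

  -- The two parts of the bound have separate origins: x comes from interlacing, and lo from
  -- strictness as the successor of the preceding entry of l.
  Interlacing⇒Between : ∀ {x lo} (k l : Vec ℕ n) → IncreasingFrom lo l → Interlacing l (x ∷ k) → Between (x ⊔ lo) k l
  Interlacing⇒Between []      []       _            p = tt
  Interlacing⇒Between (y ∷ k) (l ∷ ls) (lo≤l , inc) p =
    ℕ.⊔-lub (proj₁ (p zero)) lo≤l , proj₂ (p zero) , Interlacing⇒Between k ls inc (p ∘ suc)

  lookup-+ : ∀ (k : Vec ℕ n) j → lookup (map ℤ.+_ k) j ≡ ℤ.+ lookup k j
  lookup-+ k j = Vec.lookup-map j ℤ.+_ k

  StrictRow⁺ : ∀ (k : Vec ℕ (suc n)) → StrictlyIncreasing k → StrictRow (map ℤ.+_ k)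
  StrictRow⁺ k p j = subst₂ ℤ._<_ (sym (lookup-+ k (inject₁ j))) (sym (lookup-+ k (suc j))) (ℤ.+<+ (p j))

  StrictRow⁻ : ∀ (k : Vec ℕ (suc n)) → StrictRow (map ℤ.+_ k) → StrictlyIncreasing k
  StrictRow⁻ k p j = drop‿+<+ (subst₂ ℤ._<_ (lookup-+ k (inject₁ j)) (lookup-+ k (suc j)) (p j))

  Interlace⁺ : ∀ (l : Vec ℕ n) k → Interlacing l k → Interlace (map ℤ.+_ l) (map ℤ.+_ k)
  Interlace⁺ l k p j =
    subst₂ ℤ._≤_ (sym (lookup-+ k (inject₁ j))) (sym (lookup-+ l j)) (ℤ.+≤+ (proj₁ (p j))) ,
    subst₂ ℤ._≤_ (sym (lookup-+ l j)) (sym (lookup-+ k (suc j))) (ℤ.+≤+ (proj₂ (p j)))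

  Interlace⁻ : ∀ (l : Vec ℕ n) k → Interlace (map ℤ.+_ l) (map ℤ.+_ k) → Interlacing l k
  Interlace⁻ l k p j =
    drop‿+≤+ (subst₂ ℤ._≤_ (lookup-+ k (inject₁ j)) (lookup-+ l j) (proj₁ (p j))) ,
    drop‿+≤+ (subst₂ ℤ._≤_ (lookup-+ l j) (lookup-+ k (suc j)) (proj₂ (p j)))

  nonnegative-row : ∀ (v : Vec ℤ n) → (∀ j → 0ℤ ℤ.≤ lookup v j) → ∃ λ l → v ≡ map ℤ.+_ l
  nonnegative-row []      p = [] , refl
  nonnegative-row (i ∷ v) p =
    let l , v≡ = nonnegative-row v (p ∘ suc)
    in ℤ.∣ i ∣ ∷ l , cong₂ _∷_ (sym (0≤i⇒+∣i∣≡i (p zero))) v≡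

  Monotone⇒StrictRow : ∀ (t : Tri (suc n)) → Monotone t → StrictRow (bottom t)
  Monotone⇒StrictRow {zero}  t p           = p
  Monotone⇒StrictRow {suc n} t (_ , _ , p) = p

  triangles-sound : ∀ n (k : Vec ℕ (suc n)) {t} → IncreasingFrom 0 k → t ∈ triangles (suc n) k →
    Monotone t × bottom t ≡ map ℤ.+_ k
  triangles-sound zero    (x ∷ []) {t , r} inc t∈ = (λ ()) , proj₁ (triangles-∈⁻ t∈)
  triangles-sound (suc n) (x ∷ k)  {t , r} inc t∈ with triangles-∈⁻ {k = k} t∈
  ... | refl , l , l∈ , t∈′ = (proj₁ ih , interlace , StrictRow⁺ (x ∷ k) (IncreasingFrom⇒strict (x ∷ k) inc)) , refl
    where
    ih : Monotone t × bottom t ≡ map ℤ.+_ l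
    ih = triangles-sound n l (All.lookup (rows-increasing k inc) l∈) t∈′
    interlace : Interlace (bottom t) (map ℤ.+_ (x ∷ k))
    interlace = subst (λ v → Interlace v (map ℤ.+_ (x ∷ k))) (sym (proj₂ ih))
      (Interlace⁺ l (x ∷ k) (Between⇒Interlacing k l ℕ.≤-refl
        (rows-∈⁻ k l (IncreasingFrom-weaken (ℕ.n≤1+n x) (proj₂ inc)) l∈)))

  triangles-complete : ∀ n (k : Vec ℕ (suc n)) {t} → Monotone t → bottom t ≡ map ℤ.+_ k → t ∈ triangles (suc n) k
  triangles-complete zero    (x ∷ []) {tt , _} _ refl = here refl
  triangles-complete (suc n) (x ∷ k)  {t , _} (mono , interlace , _) refl =
    ∈-concatMap⁺ (λ l → List.map (_, map ℤ.+_ (x ∷ k)) (triangles (suc n) l))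
      (lose (rows-∈⁺ k l between) (∈-map⁺ (_, map ℤ.+_ (x ∷ k)) (triangles-complete n l mono t≡)))
    where
    row : ∃ λ l → bottom t ≡ map ℤ.+_ l
    -- Entries of `Tri` are arbitrary integers. Interlacing bounds each entry of the row above from
    -- below by an entry of `x ∷ k`, so that row has natural entries and can occur in `rows`.
    row = nonnegative-row (bottom t) λ j →
      ≤-trans (ℤ.+≤+ z≤n) (subst (ℤ._≤ lookup (bottom t) j) (lookup-+ (x ∷ k) (inject₁ j)) (proj₁ (interlace j)))
    l : Vec ℕ (suc n)
    l = proj₁ row
    t≡ : bottom t ≡ map ℤ.+_ l
    t≡ = proj₂ row
    between : Between x k l
    -- No entry precedes the first entry of l, so the part of the bound due to strictness starts at
    -- 0.
    between = subst (λ lo → Between lo k l) (ℕ.⊔-identityʳ x) (Interlacing⇒Between k l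
      (strict⇒IncreasingFrom l (StrictRow⁻ l (subst StrictRow t≡ (Monotone⇒StrictRow t mono))) z≤n)
      (Interlace⁻ l (x ∷ k) (subst (λ v → Interlace v (map ℤ.+_ (x ∷ k))) t≡ interlace)))

open import Data.Nat using (ℕ; suc)
open import Data.Fin using (Fin; inject₁)
open import Data.Vec using (Vec; lookup; map)
open import Data.Integer using (+_)
open import Data.List using (List; length)
open import Data.List.Relation.Unary.All as All using (All)
open import Data.List.Relation.Unary.Unique.Propositional using (Unique)
open import Data.List.Membership.Propositional using (_∈_)
open import Data.Product using (Σ; _×_)
open import Relation.Binary.PropositionalEquality using (_≡_; trans)
open Triangles

theorem3 : (m : ℕ) (k : Vec ℕ (suc m)) →
    ((j : Fin m) → lookup k (inject₁ j) Data.Nat.< lookup k (Fin.suc j)) →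
    Σ (List (Tri (suc m))) λ L →
    All (λ t → Monotone t × bottom t ≡ map +_ k) L × Unique L
    × ((t : Tri (suc m)) → Monotone t → bottom t ≡ map +_ k → t ∈ L)
    × theCoeff (suc m) k ≡ + length L
theorem3 m k strict = triangles (suc m) k
  , All.tabulate (triangles-sound m k increasing)
  , triangles-unique (suc m) k
  , (λ t → triangles-complete m k)
  , trans (Coefficients.theCoeff≡ m k) (VV-D-counts (suc m) k increasing)
  where
  increasing : IncreasingFrom 0 k
  increasing = strict⇒IncreasingFrom k strict z≤n
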